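{- Let $\mathcal{W}\subseteq\mathbb{R}_{>0}$ be a set having a minimum $\nu=\min(\mathcal{W})>0$. For each positive integer $\Delta$, consider the shortest $st$-path problem restricted to input multigraphs whose edge weights all belong to $\mathcal{W}$ and whose maximum degree is at most $\Delta$. Then there is no algorithm for this problem that is instance-optimal, under query or under time complexity, up to a factor of $o(\Delta)$. That is, for every function $f:\mathbb{N}\to\mathbb{R}_{>0}$ with $f(\Delta)/\Delta\to0$ as $\Delta\to\infty$, there do not exist (possibly randomized) algorithms $A_\Delta$ ($\Delta\in\mathbb{N}$), with $A_\Delta$ correct on the class for $\Delta$, meaning the class of all inputs $(G,s,t)$ in which every edge weight of the multigraph $G$ belongs to $\mathcal{W}$ and the maximum degree of $G$ is at most $\Delta$, such that for every $\Delta$, every input $x$ in the class for $\Delta$, and every (possibly randomized) algorithm $A'$ that is correct on the class for $\Delta$, $$T_{A_\Delta}(x)\le f(\Delta)\cdot T_{A'}(x);$$ this holds both when $T$ denotes the expected number of queries and when $T$ denotes the expected running time.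
   Context: Problem. An input is a (directed or undirected) multigraph $G$ (self-loops and parallel edges allowed) with vertices numbered $1,\dots,n$, with positive edge weights $\ell:E(G)\to\mathbb{R}_{>0}$, and two vertices $s,t$. The task is to return an arbitrary shortest $st$-path, given by its specific edges (or to report that $t$ is unreachable from $s$). Query model. The graph is accessible only through unit-cost queries. Undirected case: Degree$(i)$ returns the degree of vertex $i$; Edge$(i,j)$, $1\le j\le\deg(i)$, returns the $j$-th edge incident to $i$, with its weight and its other end. Directed case: Indegree$(i)$, Outdegree$(i)$, and Inedge$(i,j)$, Outedge$(i,j)$, which return the $j$-th incoming, resp. outgoing, edge of $i$ with its weight and other end. Query complexity is the expected number of queries made; in the time complexity each query costs at least one unit of time. An algorithm (possibly randomized) is correct on a class of inputs if on every input from the class it returns a correct output with probability at least $0.9$. In the $o(\cdot)$ notation $\Delta$ is not regarded as a constant. -}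

module Defs where

open import Algebra.Bundles using (CommutativeRing)
open import Data.Bool.Base using (Bool; true; false; not; if_then_else_)
open import Data.Fin.Base using (Fin; toℕ; fromℕ<)
open import Data.List.Base using (List; []; _∷_; _∷ʳ_; foldr; map; head; drop)
open import Data.List.Relation.Unary.Unique.Propositional using (Unique)
open import Data.Maybe.Base using (Maybe; just; nothing; maybe′)
import Data.Nat.Base as ℕ
open ℕ using (ℕ; zero; suc; _∸_)
import Data.Nat.DivMod as ℕ
import Data.Nat.Properties as ℕ
open import Data.Product.Base using (Σ; Σ-syntax; ∃; ∃-syntax; _×_; _,_; proj₁; proj₂)
open import Function.Base using (_∘_)
open import Function.Bundles using (_↔_; Inverse)
open import Level using (0ℓ)
open import Relation.Binary.Core using (Rel)
open import Relation.Binary.PropositionalEquality.Core using (_≡_)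
open import Relation.Binary.Structures using (IsStrictTotalOrder)
import Relation.Binary.Construct.StrictToNonStrict as StrictToNonStrict
import Algebra.Definitions.RawMonoid as RawMonoid
open import Relation.Nullary.Decidable.Core using (yes; no; does)
open import Relation.Nullary.Negation.Core using (¬_)
open import Relation.Unary using (Pred; Decidable)

-- A Dedekind-complete ordered field.  Such a field is unique up to
-- isomorphism, so quantifying over this record is speaking about ℝ.
-- Trichotomy and suprema of arbitrary bounded inhabited sets are those of
-- the classical reals.  The value of 0# ⁻¹ is irrelevant.

record Reals : Set₁ where
  field
    commutativeRing : CommutativeRing 0ℓ 0ℓ

  open CommutativeRing commutativeRing public
    renaming (Carrier to ℝ)

  infix 4 _<_
  infix 8 _⁻¹

  field
    _<_                : Rel ℝ 0ℓ
    isStrictTotalOrder : IsStrictTotalOrder _≈_ _<_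
    0<1                : 0# < 1#
    +-monoˡ-<          : ∀ z {x y} → x < y → x + z < y + z
    *-pos              : ∀ {x y} → 0# < x → 0# < y → 0# < x * y
    _⁻¹                : ℝ → ℝ
    ⁻¹-cong            : ∀ {x y} → x ≈ y → x ⁻¹ ≈ y ⁻¹
    ⁻¹-inverseʳ        : ∀ x → ¬ (x ≈ 0#) → x * x ⁻¹ ≈ 1#

  open StrictToNonStrict _≈_ _<_ public using (_≤_)
  open IsStrictTotalOrder isStrictTotalOrder public using (compare; _<?_)
  open RawMonoid +-rawMonoid public using (sum) renaming (_×_ to _times_)

  UpperBound : Pred ℝ 0ℓ → Pred ℝ 0ℓ
  UpperBound P b = ∀ x → P x → x ≤ b

  field
    complete : ∀ (P : Pred ℝ 0ℓ) → ∃ P → ∃ (UpperBound P) →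
               ∃[ u ] (UpperBound P u × (∀ b → UpperBound P b → u ≤ b))

  fromℕ : ℕ → ℝ
  fromℕ n = n times 1#

  IsMinimum : ∀ {ℓ} → Pred ℝ ℓ → ℝ → Set ℓ
  IsMinimum W ν = W ν × (∀ w → W w → ν ≤ w)

  -- f(Δ) = o(Δ), with the division by Δ > 0 cleared.
  LittleO : (ℕ → ℝ) → Set
  LittleO f = ∀ ε → 0# < ε →
    ∃[ N ] (∀ Δ → N ℕ.≤ Δ → 0 ℕ.< Δ → f Δ < ε * fromℕ Δ)

  mean : ∀ {k} → (Fin (suc k) → ℝ) → ℝ
  mean {k} f = fromℕ (suc k) ⁻¹ * sum f

data Mode : Set where
  undirected directed : Mode

-- Vertices are Fin n, edges are Fin m.  An edge e has the two ends
-- (e , false) and (e , true); a self-loop has both of them at the same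
-- vertex, so it counts twice in the degree.  The bijection says that each
-- end occupies exactly one position of exactly one incidence list.

record Undirected (n m : ℕ) : Set where
  field
    deg  : Fin n → ℕ
    ends : Σ (Fin n) (Fin ∘ deg) ↔ (Fin m × Bool)

  endpoint : Fin m × Bool → Fin n
  endpoint h = proj₁ (Inverse.from ends h)

record Directed (n m : ℕ) : Set where
  field
    outdeg indeg : Fin n → ℕ
    outs : Σ (Fin n) (Fin ∘ outdeg) ↔ Fin m
    ins  : Σ (Fin n) (Fin ∘ indeg) ↔ Fin m

  tail head′ : Fin m → Fin n
  tail  e = proj₁ (Inverse.from outs e)
  head′ e = proj₁ (Inverse.from ins e)

Structure : Mode → ℕ → ℕ → Set
Structure undirected = Undirected
Structure directed   = Directed

data Side : Mode → Set where
  incident : Side undirected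
  outgoing : Side directed
  incoming : Side directed

module _ {n m : ℕ} where

  sideDegree : ∀ {mode} → Structure mode n m → Side mode → Fin n → ℕ
  sideDegree G incident = Undirected.deg G
  sideDegree G outgoing = Directed.outdeg G
  sideDegree G incoming = Directed.indeg G

  edgeAt : ∀ {mode} (G : Structure mode n m) (k : Side mode) (v : Fin n) →
           Fin (sideDegree G k v) → Fin m × Fin n
  edgeAt G incident v j = let (e , b) = Inverse.to (Undirected.ends G) (v , j)
                          in e , Undirected.endpoint G (e , not b)
  edgeAt G outgoing v j = let e = Inverse.to (Directed.outs G) (v , j)
                          in e , Directed.head′ G e
  edgeAt G incoming v j = let e = Inverse.to (Directed.ins G) (v , j)
                          in e , Directed.tail G e

  degree : ∀ mode → Structure mode n m → Fin n → ℕ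
  degree undirected G v = Undirected.deg G v
  degree directed   G v = Directed.indeg G v ℕ.+ Directed.outdeg G v

  Joins : ∀ mode → Structure mode n m → Fin m → Fin n → Fin n → Set
  Joins undirected G e u v =
    ∃[ b ] (Undirected.endpoint G (e , b) ≡ u × Undirected.endpoint G (e , not b) ≡ v)
  Joins directed G e u v = Directed.tail G e ≡ u × Directed.head′ G e ≡ v

  -- Walk mode G u v vs es: a walk from u to v visiting vs through es.
  data Walk mode (G : Structure mode n m) :
            Fin n → Fin n → List (Fin n) → List (Fin m) → Set where
    stay : ∀ {u} → Walk mode G u u (u ∷ []) []
    move : ∀ {u v w vs es} e → Joins mode G e u v → Walk mode G v w vs es →
           Walk mode G u w (u ∷ vs) (e ∷ es)

  IsPath : ∀ mode → Structure mode n m → Fin n → Fin n → List (Fin m) → Set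
  IsPath mode G u v es = ∃[ vs ] (Walk mode G u v vs es × Unique vs)

data Measure : Set where
  queries time : Measure

-- Edges in an output path are given by their numbers.
data Output : Set where
  path        : List ℕ → Output
  unreachable : Output

data ℕOp : Set where
  plus monus times quot : ℕOp

data ℝOp : Set where
  plus minus times quot : ℝOp

natOp : ℕOp → ℕ → ℕ → ℕ
natOp plus  a b       = a ℕ.+ b
natOp monus a b       = a ∸ b
natOp times a b       = a ℕ.* b
natOp quot  a zero    = 0
natOp quot  a (suc b) = a ℕ./ suc b

toFin : ∀ n → ℕ → Maybe (Fin n)
toFin n i with i ℕ.<? n
... | yes i<n = just (fromℕ< i<n)
... | no  _   = nothing

update : ∀ {A : Set} → ℕ → A → (ℕ → A) → ℕ → A
update r a mem i = if r ℕ.≡ᵇ i then a else mem i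

module _ (R : Reals) where

  open Reals R

  record Input (mode : Mode) : Set where
    field
      {#V #E} : ℕ
      graph   : Structure mode #V #E
      weight  : Fin #E → ℝ
      s t     : Fin #V

  InClass : ∀ {ℓ mode} → Pred ℝ ℓ → ℕ → Input mode → Set ℓ
  InClass {mode = mode} W Δ x =
    (∀ e → W (weight e)) × (∀ v → degree mode graph v ℕ.≤ Δ)
    where open Input x

  module _ {mode : Mode} (x : Input mode) where
    open Input x

    pathLength : List (Fin #E) → ℝ
    pathLength = foldr (λ e l → weight e + l) 0#

    IsShortestPath : List (Fin #E) → Set
    IsShortestPath es = IsPath mode graph s t es ×
      (∀ es′ → IsPath mode graph s t es′ → pathLength es ≤ pathLength es′)

    Correct : Output → Set
    Correct (path ns)   = ∃[ es ] (ns ≡ map toℕ es × IsShortestPath es)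
    Correct unreachable = ¬ (∃[ es ] IsPath mode graph s t es)

  -- A random access machine with unbounded integer and real registers; every
  -- instruction takes one unit of time.  Arguments i, j, k, … are register
  -- numbers (indirect addressing: loadℕ, storeℕ, loadℝ, storeℝ), values are
  -- constants and targets are positions in the program; `execute` below gives
  -- the meaning.  `random i j` draws uniformly from {0,…,N} where N is the
  -- content of j.
  data Instr (mode : Mode) : Set where
    setℕ    : (i : ℕ) (value : ℕ) → Instr mode
    opℕ     : ℕOp → (i j k : ℕ) → Instr mode
    loadℕ   : (i j : ℕ) → Instr mode
    storeℕ  : (i j : ℕ) → Instr mode
    setℝ    : (i : ℕ) (value : ℝ) → Instr mode
    opℝ     : ℝOp → (i j k : ℕ) → Instr mode
    loadℝ   : (i j : ℕ) → Instr mode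
    storeℝ  : (i j : ℕ) → Instr mode
    jump    : (target : ℕ) → Instr mode
    jumpIf0 : (i : ℕ) (target : ℕ) → Instr mode
    jumpIf< : (i j : ℕ) (target : ℕ) → Instr mode
    random  : (i j : ℕ) → Instr mode
    degreeQ : Side mode → (i v : ℕ) → Instr mode
    edgeQ   : Side mode → (v j e u w : ℕ) → Instr mode
    emit    : (i : ℕ) → Instr mode
    halt    : Instr mode
    reject  : Instr mode

  Program : Mode → Set
  Program mode = List (Instr mode)

  cost : ∀ {mode} → Measure → Instr mode → ℕ
  cost time    _                     = 1
  cost queries (degreeQ _ _ _)       = 1
  cost queries (edgeQ _ _ _ _ _ _)   = 1
  cost queries _                     = 0

  record Config : Set where
    field
      pc  : ℕ
      nat : ℕ → ℕ
      rea : ℕ → ℝ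
      out : List ℕ

  -- stop nothing: abnormal termination, without an output.
  -- branch next: each of the suc k successors is equally likely.
  data Step : Set where
    stop   : Maybe Output → Step
    branch : ∀ {k} → (Fin (suc k) → Config) → Step

  goto : Config → Step
  goto c = branch {0} (λ _ → c)

  realOp : ℝOp → ℝ → ℝ → ℝ
  realOp plus  a b = a + b
  realOp minus a b = a - b
  realOp times a b = a * b
  realOp quot  a b = a * b ⁻¹

  module _ {mode : Mode} (x : Input mode) where
    open Input x

    -- Register 0 holds the number of vertices, 1 holds s and 2 holds t.
    initial : Config
    initial = record
      { pc  = 0
      ; nat = update 0 #V (update 1 (toℕ s) (update 2 (toℕ t) (λ _ → 0)))
      ; rea = λ _ → 0#
      ; out = []
      }

    module _ (c : Config) where
      open Config c

      next : Config
      next = record c { pc = suc pc }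

      putℕ : ℕ → ℕ → Config
      putℕ i a = record next { nat = update i a nat }

      putℝ : ℕ → ℝ → Config
      putℝ i a = record next { rea = update i a rea }

      execute : Instr mode → Step
      execute (setℕ i a)     = goto (putℕ i a)
      execute (opℕ o i j k)  = goto (putℕ i (natOp o (nat j) (nat k)))
      execute (loadℕ i j)    = goto (putℕ i (nat (nat j)))
      execute (storeℕ i j)   = goto (putℕ (nat i) (nat j))
      execute (setℝ i a)     = goto (putℝ i a)
      execute (opℝ o i j k)  = goto (putℝ i (realOp o (rea j) (rea k)))
      execute (loadℝ i j)    = goto (putℝ i (rea (nat j)))
      execute (storeℝ i j)   = goto (putℝ (nat i) (rea j))
      execute (jump l)       = goto (record c { pc = l })
      execute (jumpIf0 i l)  = goto (if nat i ℕ.≡ᵇ 0 then record c { pc = l } else next)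
      execute (jumpIf< i j l) =
        goto (if does (rea i <? rea j) then record c { pc = l } else next)
      execute (random i j)   = branch {nat j} (λ a → putℕ i (toℕ a))
      execute (degreeQ k i v) =
        maybe′ (λ v′ → goto (putℕ i (sideDegree graph k v′)))
               (stop nothing) (toFin #V (nat v))
      execute (edgeQ k v j e u w) =
        maybe′ (λ v′ → maybe′ (λ j′ → let (e′ , u′) = edgeAt graph k v′ j′ in
                  goto (record next
                    { nat = update u (toℕ u′) (update e (toℕ e′) nat)
                    ; rea = update w (weight e′) rea }))
                  (stop nothing) (toFin (sideDegree graph k v′) (nat j)))
               (stop nothing) (toFin #V (nat v))
      execute (emit i)       = goto (record next { out = out ∷ʳ nat i })
      execute halt           = stop (just (path out))
      execute reject         = stop (just unreachable)

    module _ (A : Program mode) where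

      fetch : Config → Maybe (Instr mode)
      fetch c = head (drop (Config.pc c) A)

      step : Config → Step
      step c = maybe′ (execute c) (stop nothing) (fetch c)

      stepCost : Measure → Config → ℝ
      stepCost μ c = maybe′ (fromℕ ∘ cost μ) 0# (fetch c)

      -- Expected cost of the first N steps from c.
      costWithin      : Measure → ℕ → Config → ℝ
      costWithinAfter : Measure → ℕ → Step → ℝ
      costWithin μ zero    c = 0#
      costWithin μ (suc N) c = stepCost μ c + costWithinAfter μ N (step c)
      costWithinAfter μ N (stop _)        = 0#
      costWithinAfter μ N (branch c)      = mean (λ i → costWithin μ N (c i))

      -- Probability of halting within N steps from c with an output in S.
      probWithin      : ∀ {S : Pred Output 0ℓ} → Decidable S → ℕ → Config → ℝ
      probWithinAfter : ∀ {S : Pred Output 0ℓ} → Decidable S → ℕ → Step → ℝ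
      probWithin S? zero    c = 0#
      probWithin S? (suc N) c = probWithinAfter S? N (step c)
      probWithinAfter S? N (stop nothing)  = 0#
      probWithinAfter S? N (stop (just o)) = if does (S? o) then 1# else 0#
      probWithinAfter S? N (branch c)      = mean (λ i → probWithin S? N (c i))

      -- The probability of a correct output is the supremum (limit) of
      -- probWithin over N.  A decision procedure for correctness only serves
      -- to make the indicator function of the event available.
      SucceedsWithProbability≥ : ℝ → Set
      SucceedsWithProbability≥ p = Σ[ correct? ∈ Decidable (Correct x) ]
        (∀ q → q < p → ∃[ N ] (q < probWithin correct? N initial))

      -- The expected cost E[T] ∈ [0,∞] is the supremum of costWithin over N.
      ExpectedCost≤ : Measure → ℝ → Set
      ExpectedCost≤ μ r = ∀ N → costWithin μ N initial ≤ r

  CorrectOn : ∀ {ℓ mode} → Pred (Input mode) ℓ → Program mode → Set ℓ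
  CorrectOn C A = ∀ x → C x →
    SucceedsWithProbability≥ x A (fromℕ 9 * fromℕ 10 ⁻¹)

  -- T_A(x) ≤ c · T_B(x) in [0,∞], for c > 0: every real upper bound r of
  -- T_B(x) yields the upper bound c · r of T_A(x).
  CostAtMost : ∀ {mode} → Measure → Input mode → (A : Program mode) →
               ℝ → (B : Program mode) → Set
  CostAtMost μ x A c B = ∀ r → ExpectedCost≤ x B μ r → ExpectedCost≤ x A μ (c * r)

  InstanceOptimal : ∀ {ℓ mode} → Measure → Pred (Input mode) ℓ → ℝ → Program mode → Set ℓ
  InstanceOptimal μ C c A = CorrectOn C A ×
    (∀ x → C x → ∀ A′ → CorrectOn C A′ → CostAtMost μ x A c A′)

{-# OPTIONS --safe #-}

-- Let Δ = 2M.  On two vertices s, t take M loops at each of them; in the k-th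
-- variant the k-th loop at s and the k-th loop at t are exchanged for two edges
-- joining s and t.  All weights are ν.  An algorithm that knows k looks at the
-- one position of s concerned and, since no weight is below ν, may output the
-- edge found there; if the test fails it falls back on A itself, so it is correct
-- on the whole class and costs O(1) on the k-th variant.  On the other hand t is
-- unreachable in the unmodified graph, and until A queries block k it cannot tell
-- that graph from the k-th variant.  A run of q queries touches at most q blocks,
-- so on average over k the algorithm A makes Ω(M) queries on the k-th variant.

module Submission where

open import Defs
import Algebra.Properties.CommutativeMonoid.Sum as CommutativeMonoidSum
import Algebra.Properties.Semiring.Mult as SemiringMult
import Algebra.Properties.Semiring.Sum as SemiringSum
import Algebra.Solver.Ring.NaturalCoefficients.Default as SemiringSolver
open import Data.Bool.Base using (Bool; true; false; _∧_; if_then_else_)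
import Data.Bool.Properties as Bool
open import Data.Fin.Base using (Fin; zero; suc; toℕ; fromℕ<; combine; remQuot)
import Data.Fin.Properties as Fin
open import Data.List.Base using (List; []; _∷_; _++_; map; head; drop; length)
open import Data.List.Relation.Unary.All using ([]; _∷_)
open import Data.List.Relation.Unary.AllPairs using ([]; _∷_)
import Data.Maybe.Base as Maybe
open Maybe using (Maybe; just; nothing; maybe′)
open import Data.Maybe.Properties using (just-injective)
import Data.Nat.Base as ℕ
open ℕ using (ℕ; zero; suc; _∸_) renaming (_<_ to _<ℕ_)
import Data.Nat.Properties as ℕ
open import Data.Product.Base using (Σ; Σ-syntax; ∃-syntax; _×_; _,_; proj₁; proj₂)
open import Data.Sum.Base using (inj₁; inj₂)
open import Function.Base using (_∘_)
open import Function.Bundles using (Inverse; mk↔ₛ′)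
open import Level using (0ℓ)
open import Relation.Binary.Bundles using (StrictPartialOrder)
import Relation.Binary.Construct.StrictToNonStrict as StrictToNonStrict
open import Relation.Binary.Definitions using (tri<; tri≈; tri>)
open import Relation.Binary.PropositionalEquality as ≡ using (_≡_; _≢_; refl; cong; cong₂; subst)
import Relation.Binary.Reasoning.Setoid as SetoidReasoning
import Relation.Binary.Reasoning.StrictPartialOrder as StrictPartialOrderReasoning
open import Relation.Binary.Structures using (IsStrictTotalOrder)
open import Relation.Nullary.Decidable using (dec-true; dec-false)
open import Relation.Nullary.Decidable.Core using (yes; no; does)
open import Relation.Nullary.Negation.Core using (¬_; contradiction)
open import Relation.Unary using (Pred; Decidable)

-- Instance optimality bounds the cost of A on the variants only, by F = 17 f(Δ). On the unmodified
-- graph nothing is known, and the number N of steps after which A succeeds often enough is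
-- arbitrary, so touches cannot be counted over a whole run. They are counted among the first Q
-- touching queries only, which caps their sum over k by Q. A run that exceeds this budget before
-- touching block k does so on the k-th variant as well, where the excess is charged to F; this is
-- Markov's inequality, multiplied through by Q to avoid a division. If θ is a success probability
-- reached within N steps on all these inputs, then 2θMQ ≤ Q² + MF + MQ. For M = 2Q and θ = 0.8 this
-- fails once 10F < Q, and o(Δ) supplies such a Q because Δ = 4Q. The other obstacle is that the
-- competitor must keep the success probability 0.9 on every input. The fallback therefore has to
-- reproduce the run of A exactly, from restored registers and with its jump targets moved.

-- Ordered field arithmetic, finite sums and means

module RealProperties (R : Reals) where

  open Reals R hiding (zero; refl)
  open IsStrictTotalOrder isStrictTotalOrder public
    using (isStrictPartialOrder; <-resp-≈; <-respˡ-≈; <-respʳ-≈)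
    renaming (trans to <-trans; irrefl to <-irrefl; asym to <-asym)
  module NonStrict = StrictToNonStrict _≈_ _<_
  open CommutativeMonoidSum +-commutativeMonoid using (∑-distrib-+; ∑-comm; sum-replicate; sum-cong-≋)
  open SemiringSum semiring using (*-distribˡ-sum)
  open SemiringMult semiring using (×1-homo-*; ×-assoc-*; ×-congʳ)

  strictPartialOrder : StrictPartialOrder 0ℓ 0ℓ 0ℓ
  strictPartialOrder = record { isStrictPartialOrder = isStrictPartialOrder }

  module Reasoning = StrictPartialOrderReasoning strictPartialOrder
  module Solver = SemiringSolver commutativeSemiring

  ≤-refl : ∀ {x} → x ≤ x
  ≤-refl = inj₂ (Reals.refl R)

  ≤-reflexive : ∀ {x y} → x ≈ y → x ≤ y
  ≤-reflexive = inj₂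

  ≤-trans : ∀ {x y z} → x ≤ y → y ≤ z → x ≤ z
  ≤-trans = NonStrict.trans isEquivalence <-resp-≈ <-trans

  <⇒≱ : ∀ {x y} → x < y → ¬ (y ≤ x)
  <⇒≱ x<y (inj₁ y<x) = <-asym x<y y<x
  <⇒≱ x<y (inj₂ y≈x) = <-irrefl (sym y≈x) x<y

  ≮⇒≥ : ∀ {x y} → ¬ (x < y) → y ≤ x
  ≮⇒≥ {x} {y} x≮y with compare x y
  ... | tri< x<y _ _ = contradiction x<y x≮y
  ... | tri≈ _ x≈y _ = inj₂ (sym x≈y)
  ... | tri> _ _ y<x = inj₁ y<x

  +-monoˡ-≤ : ∀ z {x y} → x ≤ y → x + z ≤ y + z
  +-monoˡ-≤ z (inj₁ x<y) = inj₁ (+-monoˡ-< z x<y)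
  +-monoˡ-≤ z (inj₂ x≈y) = inj₂ (+-congʳ x≈y)

  +-monoʳ-≤ : ∀ z {x y} → x ≤ y → z + x ≤ z + y
  +-monoʳ-≤ z {x} {y} x≤y = begin
    z + x ≈⟨ +-comm z x ⟩
    x + z ≤⟨ +-monoˡ-≤ z x≤y ⟩
    y + z ≈⟨ +-comm y z ⟩
    z + y ∎
    where open Reasoning

  +-mono-≤ : ∀ {x y u v} → x ≤ y → u ≤ v → x + u ≤ y + v
  +-mono-≤ x≤y u≤v = ≤-trans (+-monoˡ-≤ _ x≤y) (+-monoʳ-≤ _ u≤v)

  +-mono-<-≤ : ∀ {x y u v} → x < y → u ≤ v → x + u < y + v
  +-mono-<-≤ {x} {y} {u} {v} x<y u≤v = begin-strict
    x + u <⟨ +-monoˡ-< u x<y ⟩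
    y + u ≤⟨ +-monoʳ-≤ y u≤v ⟩
    y + v ∎
    where open Reasoning

  x≤x+y : ∀ x {y} → 0# ≤ y → x ≤ x + y
  x≤x+y x {y} 0≤y = begin
    x      ≈⟨ +-identityʳ x ⟨
    x + 0# ≤⟨ +-monoʳ-≤ x 0≤y ⟩
    x + y  ∎
    where open Reasoning

  y≤x+y : ∀ {x} y → 0# ≤ x → y ≤ x + y
  y≤x+y y 0≤x = ≤-trans (x≤x+y y 0≤x) (≤-reflexive (+-comm y _))

  0≤x+y : ∀ {x y} → 0# ≤ x → 0# ≤ y → 0# ≤ x + y
  0≤x+y {x} 0≤x 0≤y = ≤-trans 0≤x (x≤x+y x 0≤y)

  private
    x+y-x≈y : ∀ x y → x + (y - x) ≈ y
    x+y-x≈y x y = begin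
      x + (y - x)   ≈⟨ +-congˡ (+-comm y (- x)) ⟩
      x + (- x + y) ≈⟨ +-assoc x (- x) y ⟨
      (x - x) + y   ≈⟨ +-congʳ (-‿inverseʳ x) ⟩
      0# + y        ≈⟨ +-identityˡ y ⟩
      y             ∎
      where open SetoidReasoning setoid

  *-monoˡ-< : ∀ {z} → 0# < z → ∀ {x y} → x < y → z * x < z * y
  *-monoˡ-< {z} 0<z {x} {y} x<y = begin-strict
    z * x               ≈⟨ +-identityˡ (z * x) ⟨
    0# + z * x          <⟨ +-monoˡ-< (z * x) (*-pos 0<z 0<y-x) ⟩
    z * (y - x) + z * x ≈⟨ +-comm _ _ ⟩
    z * x + z * (y - x) ≈⟨ distribˡ z x (y - x) ⟨
    z * (x + (y - x))   ≈⟨ *-congˡ (x+y-x≈y x y) ⟩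
    z * y               ∎
    where
    open Reasoning
    0<y-x : 0# < y - x
    0<y-x = <-respˡ-≈ (-‿inverseʳ x) (+-monoˡ-< (- x) x<y)

  *-monoˡ-≤ : ∀ {z} → 0# ≤ z → ∀ {x y} → x ≤ y → z * x ≤ z * y
  *-monoˡ-≤ 0≤z (inj₂ x≈y) = inj₂ (*-congˡ x≈y)
  *-monoˡ-≤ (inj₁ 0<z) (inj₁ x<y) = inj₁ (*-monoˡ-< 0<z x<y)
  *-monoˡ-≤ {z} (inj₂ 0≈z) {x} {y} (inj₁ _) = inj₂ (trans (z*≈0 x) (sym (z*≈0 y)))
    where
    z*≈0 : ∀ w → z * w ≈ 0#
    z*≈0 w = trans (*-congʳ (sym 0≈z)) (zeroˡ w)

  0≤x*y : ∀ {x y} → 0# ≤ x → 0# ≤ y → 0# ≤ x * y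
  0≤x*y {x} {y} 0≤x 0≤y = ≤-trans (≤-reflexive (sym (zeroʳ x))) (*-monoˡ-≤ 0≤x 0≤y)

  *-cancelˡ-< : ∀ {z} → 0# ≤ z → ∀ {x y} → z * x < z * y → x < y
  *-cancelˡ-< 0≤z {x} {y} zx<zy with compare x y
  ... | tri< x<y _ _ = x<y
  ... | tri≈ _ x≈y _ = contradiction (≤-reflexive (*-congˡ (sym x≈y))) (<⇒≱ zx<zy)
  ... | tri> _ _ y<x = contradiction (*-monoˡ-≤ 0≤z (inj₁ y<x)) (<⇒≱ zx<zy)

  0≤1 : 0# ≤ 1#
  0≤1 = inj₁ 0<1

  >⇒≉ : ∀ {x} → 0# < x → ¬ (x ≈ 0#)
  >⇒≉ 0<x x≈0 = <-irrefl (sym x≈0) 0<x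

  ⁻¹-pos : ∀ {x} → 0# < x → 0# < x ⁻¹
  ⁻¹-pos {x} 0<x with compare 0# (x ⁻¹)
  ... | tri< 0<x⁻¹ _ _ = 0<x⁻¹
  ... | tri≈ _ 0≈x⁻¹ _ = contradiction (≤-reflexive 1≈0) (<⇒≱ 0<1)
    where
    1≈0 : 1# ≈ 0#
    1≈0 = trans (sym (⁻¹-inverseʳ x (>⇒≉ 0<x))) (trans (*-congˡ (sym 0≈x⁻¹)) (zeroʳ x))
  ... | tri> _ _ x⁻¹<0 = contradiction 1<0 (<-asym 0<1)
    where
    1<0 : 1# < 0#
    1<0 = <-respˡ-≈ (⁻¹-inverseʳ x (>⇒≉ 0<x)) (<-respʳ-≈ (zeroʳ x) (*-monoˡ-< 0<x x⁻¹<0))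

  fromℕ-* : ∀ a b → fromℕ (a ℕ.* b) ≈ fromℕ a * fromℕ b
  fromℕ-* = ×1-homo-*

  fromℕ-1 : fromℕ 1 ≈ 1#
  fromℕ-1 = +-identityʳ 1#

  0≤fromℕ : ∀ n → 0# ≤ fromℕ n
  0≤fromℕ zero    = ≤-refl
  0≤fromℕ (suc n) = 0≤x+y 0≤1 (0≤fromℕ n)

  0<fromℕ : ∀ n → 0# < fromℕ (suc n)
  0<fromℕ n = <-respˡ-≈ (+-identityˡ 0#) (+-mono-<-≤ 0<1 (0≤fromℕ n))

  fromℕ-mono-≤ : ∀ {a b} → a ℕ.≤ b → fromℕ a ≤ fromℕ b
  fromℕ-mono-≤ {b = b} ℕ.z≤n = 0≤fromℕ b
  fromℕ-mono-≤ (ℕ.s≤s a≤b)   = +-monoʳ-≤ 1# (fromℕ-mono-≤ a≤b)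

  fromℕ-mono-< : ∀ {a b} → a ℕ.< b → fromℕ a < fromℕ b
  fromℕ-mono-< {a} {b} a<b = begin-strict
    fromℕ a       ≈⟨ +-identityˡ _ ⟨
    0# + fromℕ a  <⟨ +-monoˡ-< (fromℕ a) 0<1 ⟩
    fromℕ (suc a) ≤⟨ fromℕ-mono-≤ a<b ⟩
    fromℕ b       ∎
    where open Reasoning

  sum-cong : ∀ {n} {f g : Fin n → ℝ} → (∀ i → f i ≈ g i) → sum f ≈ sum g
  sum-cong = sum-cong-≋

  sum-mono : ∀ {n} {f g : Fin n → ℝ} → (∀ i → f i ≤ g i) → sum f ≤ sum g
  sum-mono {zero}  f≤g = ≤-refl
  sum-mono {suc n} f≤g = +-mono-≤ (f≤g zero) (sum-mono (λ i → f≤g (suc i)))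

  sum-+ : ∀ {n} (f g : Fin n → ℝ) → sum (λ i → f i + g i) ≈ sum f + sum g
  sum-+ = ∑-distrib-+

  sum-* : ∀ {n} z (f : Fin n → ℝ) → sum (λ i → z * f i) ≈ z * sum f
  sum-* z f = sym (*-distribˡ-sum z f)

  sum-const : ∀ n z → sum {n} (λ _ → z) ≈ fromℕ n * z
  sum-const n z = trans (sum-replicate n)
    (trans (×-congʳ n (sym (*-identityˡ z))) (sym (×-assoc-* n 1# z)))

  mean-cong : ∀ {n} {f g : Fin (suc n) → ℝ} → (∀ i → f i ≈ g i) → mean f ≈ mean g
  mean-cong f≈g = *-congˡ (sum-cong f≈g)

  mean-mono : ∀ {n} {f g : Fin (suc n) → ℝ} → (∀ i → f i ≤ g i) → mean f ≤ mean g
  mean-mono {n} f≤g = *-monoˡ-≤ (inj₁ (⁻¹-pos (0<fromℕ n))) (sum-mono f≤g)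

  mean-const : ∀ n z → mean {n} (λ _ → z) ≈ z
  mean-const n z = begin
    N ⁻¹ * sum {suc n} (λ _ → z) ≈⟨ *-congˡ (sum-const (suc n) z) ⟩
    N ⁻¹ * (N * z)               ≈⟨ *-assoc _ _ _ ⟨
    (N ⁻¹ * N) * z               ≈⟨ *-congʳ (*-comm _ _) ⟩
    (N * N ⁻¹) * z               ≈⟨ *-congʳ (⁻¹-inverseʳ N (>⇒≉ (0<fromℕ n))) ⟩
    1# * z                       ≈⟨ *-identityˡ z ⟩
    z                            ∎
    where
    open SetoidReasoning setoid
    N = fromℕ (suc n)

  mean-singleton : ∀ (f : Fin 1 → ℝ) → mean f ≈ f zero
  mean-singleton f = mean-const 0 (f zero)

  mean-+ : ∀ {n} (f g : Fin (suc n) → ℝ) → mean (λ i → f i + g i) ≈ mean f + mean g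
  mean-+ f g = trans (*-congˡ (sum-+ f g)) (distribˡ _ _ _)

  mean-* : ∀ {n} z (f : Fin (suc n) → ℝ) → mean (λ i → z * f i) ≈ z * mean f
  mean-* {n} z f = trans (*-congˡ (sum-* z f))
    (solve 3 (λ a b c → a :* (b :* c) := b :* (a :* c)) (Reals.refl R) (fromℕ (suc n) ⁻¹) z (sum f))
    where open Solver

  mean-sum : ∀ {m n} (f : Fin m → Fin (suc n) → ℝ) →
             mean (λ i → sum (λ j → f j i)) ≈ sum (λ j → mean (f j))
  mean-sum f = trans (*-congˡ (∑-comm (λ i j → f j i))) (sym (sum-* _ (λ j → sum (f j))))

  mean≤ : ∀ {n z} {f : Fin (suc n) → ℝ} → (∀ i → f i ≤ z) → mean f ≤ z
  mean≤ {n} {z} f≤z = ≤-trans (mean-mono f≤z) (≤-reflexive (mean-const n z))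

  ≤mean : ∀ {n z} {f : Fin (suc n) → ℝ} → (∀ i → z ≤ f i) → z ≤ mean f
  ≤mean {n} {z} z≤f = ≤-trans (≤-reflexive (sym (mean-const n z))) (mean-mono z≤f)

-- Success probabilities and costs along runs

toFin-toℕ : ∀ {n} (i : Fin n) → toFin n (toℕ i) ≡ just i
toFin-toℕ {n} i with toℕ i ℕ.<? n
... | yes i<n = cong just (Fin.fromℕ<-toℕ i i<n)
... | no  i≮n = contradiction (Fin.toℕ<n i) i≮n

toFin-just : ∀ {n j} (i : Fin n) → toℕ i ≡ j → toFin n j ≡ just i
toFin-just i refl = toFin-toℕ i

module Runs (R : Reals) {mode : Mode} (x : Input R mode) (A : Program R mode) where

  open Reals R hiding (zero; refl)
  open RealProperties R

  module _ {S : Pred Output 0ℓ} (S? : Decidable S) where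

    mutual
      0≤probWithin : ∀ N c → 0# ≤ probWithin R x A S? N c
      0≤probWithin zero    c = ≤-refl
      0≤probWithin (suc N) c = 0≤probWithinAfter N (step R x A c)

      0≤probWithinAfter : ∀ N s → 0# ≤ probWithinAfter R x A S? N s
      0≤probWithinAfter N (stop nothing)  = ≤-refl
      0≤probWithinAfter N (stop (just o)) with does (S? o)
      ... | true  = 0≤1
      ... | false = ≤-refl
      0≤probWithinAfter N (branch c) = ≤mean (λ i → 0≤probWithin N (c i))

    mutual
      probWithin≤1 : ∀ N c → probWithin R x A S? N c ≤ 1#
      probWithin≤1 zero    c = 0≤1
      probWithin≤1 (suc N) c = probWithinAfter≤1 N (step R x A c)

      probWithinAfter≤1 : ∀ N s → probWithinAfter R x A S? N s ≤ 1#
      probWithinAfter≤1 N (stop nothing)  = 0≤1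
      probWithinAfter≤1 N (stop (just o)) with does (S? o)
      ... | true  = ≤-refl
      ... | false = 0≤1
      probWithinAfter≤1 N (branch c) = mean≤ (λ i → probWithin≤1 N (c i))

    mutual
      probWithin-mono : ∀ {M N} → M ℕ.≤ N → ∀ c →
                        probWithin R x A S? M c ≤ probWithin R x A S? N c
      probWithin-mono {N = N} ℕ.z≤n       c = 0≤probWithin N c
      probWithin-mono         (ℕ.s≤s M≤N) c = probWithinAfter-mono M≤N (step R x A c)

      probWithinAfter-mono : ∀ {M N} → M ℕ.≤ N → ∀ s →
                             probWithinAfter R x A S? M s ≤ probWithinAfter R x A S? N s
      probWithinAfter-mono M≤N (stop nothing)  = ≤-refl
      probWithinAfter-mono M≤N (stop (just o)) = ≤-refl
      probWithinAfter-mono M≤N (branch c)      = mean-mono (λ i → probWithin-mono M≤N (c i))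

  stepCost≤1 : ∀ μ c → stepCost R x A μ c ≤ 1#
  stepCost≤1 μ c with fetch R x A c
  ... | nothing = 0≤1
  ... | just i  = ≤-trans (fromℕ-mono-≤ (cost≤1 μ i)) (≤-reflexive fromℕ-1)
    where
    cost≤1 : ∀ μ i → cost R μ i ℕ.≤ 1
    cost≤1 time    i                   = ℕ.≤-refl
    cost≤1 queries (setℕ _ _)          = ℕ.z≤n
    cost≤1 queries (opℕ _ _ _ _)       = ℕ.z≤n
    cost≤1 queries (loadℕ _ _)         = ℕ.z≤n
    cost≤1 queries (storeℕ _ _)        = ℕ.z≤n
    cost≤1 queries (setℝ _ _)          = ℕ.z≤n
    cost≤1 queries (opℝ _ _ _ _)       = ℕ.z≤n
    cost≤1 queries (loadℝ _ _)         = ℕ.z≤n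
    cost≤1 queries (storeℝ _ _)        = ℕ.z≤n
    cost≤1 queries (jump _)            = ℕ.z≤n
    cost≤1 queries (jumpIf0 _ _)       = ℕ.z≤n
    cost≤1 queries (jumpIf< _ _ _)     = ℕ.z≤n
    cost≤1 queries (random _ _)        = ℕ.z≤n
    cost≤1 queries (degreeQ _ _ _)     = ℕ.≤-refl
    cost≤1 queries (edgeQ _ _ _ _ _ _) = ℕ.≤-refl
    cost≤1 queries (emit _)            = ℕ.z≤n
    cost≤1 queries halt                = ℕ.z≤n
    cost≤1 queries reject              = ℕ.z≤n

  0≤stepCost : ∀ μ c → 0# ≤ stepCost R x A μ c
  0≤stepCost μ c with fetch R x A c
  ... | nothing = ≤-refl
  ... | just i  = 0≤fromℕ (cost R μ i)

  mutual
    0≤costWithin : ∀ μ N c → 0# ≤ costWithin R x A μ N c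
    0≤costWithin μ zero    c = ≤-refl
    0≤costWithin μ (suc N) c = 0≤x+y (0≤stepCost μ c) (0≤costWithinAfter μ N (step R x A c))

    0≤costWithinAfter : ∀ μ N s → 0# ≤ costWithinAfter R x A μ N s
    0≤costWithinAfter μ N (stop _)   = ≤-refl
    0≤costWithinAfter μ N (branch c) = ≤mean (λ i → 0≤costWithin μ N (c i))

  infixr 5 _∷_
  infix  4 _⟶⟨_⟩_

  -- Only steps with a single successor are chained. The probe draws no random numbers, so this
  -- suffices and no averaging over branches arises.
  data _⟶⟨_⟩_ : Config R → ℕ → Config R → Set where
    []  : ∀ {c} → c ⟶⟨ 0 ⟩ c
    _∷_ : ∀ {c d e n} → step R x A c ≡ goto R d → d ⟶⟨ n ⟩ e → c ⟶⟨ suc n ⟩ e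

  infixr 5 _⊕_
  _⊕_ : ∀ {c d e m n} → c ⟶⟨ m ⟩ d → d ⟶⟨ n ⟩ e → c ⟶⟨ m ℕ.+ n ⟩ e
  []      ⊕ q = q
  (s ∷ p) ⊕ q = s ∷ (p ⊕ q)

  probWithin-⟶ : ∀ {S : Pred Output 0ℓ} (S? : Decidable S) {c d n} → c ⟶⟨ n ⟩ d → ∀ N →
                 probWithin R x A S? (n ℕ.+ N) c ≈ probWithin R x A S? N d
  probWithin-⟶ S? []      N = Reals.refl R
  probWithin-⟶ S? (_∷_ {d = d} {n = n} s p) N rewrite s =
    trans (mean-singleton (λ _ → probWithin R x A S? (n ℕ.+ N) d)) (probWithin-⟶ S? p N)

  -- No instruction costs more than 1 under either measure. The stopping step is charged too, hence
  -- `suc n`.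
  costWithin-⟶-stop : ∀ μ {c d n o} → c ⟶⟨ n ⟩ d → step R x A d ≡ stop o → ∀ N →
                      costWithin R x A μ N c ≤ fromℕ (suc n)
  costWithin-⟶-stop μ {n = n} p h zero = 0≤fromℕ (suc n)
  costWithin-⟶-stop μ {c} [] h (suc N) rewrite h = +-monoˡ-≤ 0# (stepCost≤1 μ c)
  costWithin-⟶-stop μ {c} (_∷_ {d = d} s p) h (suc N) rewrite s =
    +-mono-≤ (stepCost≤1 μ c)
      (≤-trans (≤-reflexive (mean-singleton (λ _ → costWithin R x A μ N d))) (costWithin-⟶-stop μ p h N))

-- Moving a program behind a prefix

update-cong : ∀ {A : Set} {m m′ : ℕ → A} r a → (∀ i → m i ≡ m′ i) →
              ∀ i → update r a m i ≡ update r a m′ i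
update-cong r a m≗m′ i with r ℕ.≡ᵇ i
... | true  = refl
... | false = m≗m′ i

head-drop-++ : ∀ {A : Set} (xs ys : List A) n →
               head (drop (length xs ℕ.+ n) (xs ++ ys)) ≡ head (drop n ys)
head-drop-++ []       ys n = refl
head-drop-++ (x ∷ xs) ys n = head-drop-++ xs ys n

head-drop-map : ∀ {A B : Set} (f : A → B) xs n →
                head (drop n (map f xs)) ≡ Maybe.map f (head (drop n xs))
head-drop-map f []       zero    = refl
head-drop-map f []       (suc n) = refl
head-drop-map f (x ∷ xs) zero    = refl
head-drop-map f (x ∷ xs) (suc n) = head-drop-map f xs n

module Relocation (R : Reals) {mode : Mode} where

  open Reals R hiding (zero; refl)
  open RealProperties R

  relocate : ℕ → Instr R mode → Instr R mode
  relocate L (jump l)        = jump (L ℕ.+ l)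
  relocate L (jumpIf0 i l)   = jumpIf0 i (L ℕ.+ l)
  relocate L (jumpIf< i j l) = jumpIf< i j (L ℕ.+ l)
  relocate L i               = i

  prepend : Program R mode → Program R mode → Program R mode
  prepend P A = P ++ map (relocate (length P)) A

  -- The two memories arise from different chains of updates, so they are compared register by
  -- register.
  record Shifted (L : ℕ) (c d : Config R) : Set where
    constructor shifted
    open Config
    field
      pc≡  : pc d ≡ L ℕ.+ pc c
      nat≗ : ∀ i → nat c i ≡ nat d i
      rea≗ : ∀ i → rea c i ≡ rea d i
      out≡ : out c ≡ out d

  -- A coupling: the same random choice leads to shifted configurations, so the means agree term by
  -- term.
  data ShiftedStep (L : ℕ) : Step R → Step R → Set where
    stop   : ∀ o → ShiftedStep L (stop o) (stop o)
    branch : ∀ {k} {c d : Fin (suc k) → Config R} → (∀ i → Shifted L (c i) (d i)) →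
             ShiftedStep L (branch c) (branch d)

  module _ (x : Input R mode) (L : ℕ) where

    open Input x

    execute-relocate : ∀ {c d} → Shifted L c d → ∀ i →
                       ShiftedStep L (execute R x c i) (execute R x d (relocate L i))
    execute-relocate {c} {d} (shifted pc≡ nat≗ rea≗ out≡) = go
      where
      open Config

      next≡ : suc (pc d) ≡ L ℕ.+ suc (pc c)
      next≡ = ≡.trans (cong suc pc≡) (≡.sym (ℕ.+-suc L (pc c)))

      next-shifted : Shifted L (next R x c) (next R x d)
      next-shifted = shifted next≡ nat≗ rea≗ out≡

      jump-shifted : ∀ l → Shifted L (record c { pc = l }) (record d { pc = L ℕ.+ l })
      jump-shifted l = shifted refl nat≗ rea≗ out≡

      putℕ-shifted : ∀ r a → Shifted L (putℕ R x c r a) (putℕ R x d r a)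
      putℕ-shifted r a = shifted next≡ (update-cong r a nat≗) rea≗ out≡

      putℝ-shifted : ∀ r a → Shifted L (putℝ R x c r a) (putℝ R x d r a)
      putℝ-shifted r a = shifted next≡ nat≗ (update-cong r a rea≗) out≡

      if-shifted : ∀ b l → Shifted L (if b then record c { pc = l } else next R x c)
                                     (if b then record d { pc = L ℕ.+ l } else next R x d)
      if-shifted true  l = jump-shifted l
      if-shifted false l = next-shifted

      go : ∀ i → ShiftedStep L (execute R x c i) (execute R x d (relocate L i))
      go (setℕ i a)      = branch (λ _ → putℕ-shifted i a)
      go (opℕ o i j k)   rewrite nat≗ j | nat≗ k = branch (λ _ → putℕ-shifted i _)
      go (loadℕ i j)     rewrite nat≗ j | nat≗ (nat d j) = branch (λ _ → putℕ-shifted i _)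
      go (storeℕ i j)    rewrite nat≗ i | nat≗ j = branch (λ _ → putℕ-shifted (nat d i) (nat d j))
      go (setℝ i a)      = branch (λ _ → putℝ-shifted i a)
      go (opℝ o i j k)   rewrite rea≗ j | rea≗ k = branch (λ _ → putℝ-shifted i _)
      go (loadℝ i j)     rewrite nat≗ j | rea≗ (nat d j) = branch (λ _ → putℝ-shifted i _)
      go (storeℝ i j)    rewrite nat≗ i | rea≗ j = branch (λ _ → putℝ-shifted (nat d i) (rea d j))
      go (jump l)        = branch (λ _ → jump-shifted l)
      go (jumpIf0 i l)   rewrite nat≗ i = branch (λ _ → if-shifted _ l)
      go (jumpIf< i j l) rewrite rea≗ i | rea≗ j = branch (λ _ → if-shifted _ l)
      go (random i j)    rewrite nat≗ j = branch (λ a → putℕ-shifted i (toℕ a))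
      go (degreeQ k i v) rewrite nat≗ v with toFin #V (nat d v)
      ... | just v′ = branch (λ _ → putℕ-shifted i _)
      ... | nothing = stop nothing
      go (edgeQ k v j e u w) rewrite nat≗ v | nat≗ j with toFin #V (nat d v)
      ... | nothing = stop nothing
      ... | just v′ with toFin (sideDegree graph k v′) (nat d j)
      ...   | nothing = stop nothing
      ...   | just j′ = branch (λ _ → shifted next≡
                          (update-cong u _ (update-cong e _ nat≗)) (update-cong w _ rea≗) out≡)
      go (emit i)        rewrite nat≗ i | out≡ = branch (λ _ → shifted next≡ nat≗ rea≗ refl)
      go halt            rewrite out≡ = stop _
      go reject          = stop _

  module _ (x : Input R mode) (P A : Program R mode) where

    private
      L = length P
      B = prepend P A

    -- Since A comes last in the combined program, leaving A at its end means leaving the combined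
    -- program, and abnormal termination is preserved.
    fetch-prepend : ∀ {c d} → Shifted L c d →
                    fetch R x B d ≡ Maybe.map (relocate L) (fetch R x A c)
    fetch-prepend {c} {d} (shifted pc≡ _ _ _) = begin
      head (drop (pc d) B)                          ≡⟨ cong (λ p → head (drop p B)) pc≡ ⟩
      head (drop (L ℕ.+ pc c) B)                    ≡⟨ head-drop-++ P _ (pc c) ⟩
      head (drop (pc c) (map (relocate L) A))       ≡⟨ head-drop-map (relocate L) A (pc c) ⟩
      Maybe.map (relocate L) (head (drop (pc c) A)) ∎
      where
      open Config
      open ≡.≡-Reasoning

    step-prepend : ∀ {c d} → Shifted L c d → ShiftedStep L (step R x A c) (step R x B d)
    step-prepend {c} sh rewrite fetch-prepend sh with fetch R x A c
    ... | nothing = stop nothing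
    ... | just i  = execute-relocate x L sh i

    module _ {S : Pred Output 0ℓ} (S? : Decidable S) where

      mutual
        probWithin-prepend : ∀ N {c d} → Shifted L c d →
                             probWithin R x A S? N c ≈ probWithin R x B S? N d
        probWithin-prepend zero    sh = Reals.refl R
        probWithin-prepend (suc N) sh = probWithinAfter-prepend N (step-prepend sh)

        probWithinAfter-prepend : ∀ N {s s′} → ShiftedStep L s s′ →
                                  probWithinAfter R x A S? N s ≈ probWithinAfter R x B S? N s′
        probWithinAfter-prepend N (stop nothing)  = Reals.refl R
        probWithinAfter-prepend N (stop (just o)) = Reals.refl R
        probWithinAfter-prepend N (branch sh)     = mean-cong (λ i → probWithin-prepend N (sh i))

-- The competitor with a built-in guess

≡ᵇ0-true : ∀ {n} → n ≡ 0 → (n ℕ.≡ᵇ 0) ≡ true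
≡ᵇ0-true refl = refl

≡ᵇ0-false : ∀ {n} → n ≢ 0 → (n ℕ.≡ᵇ 0) ≡ false
≡ᵇ0-false {zero}  n≢0 = contradiction refl n≢0
≡ᵇ0-false {suc n} n≢0 = refl

-- The machine can test natural registers only for 0; with truncated subtraction this sum is the
-- distance of m and n, which turns equality into such a test.
∸+∸≡0⇒≡ : ∀ {m n} → (m ∸ n) ℕ.+ (n ∸ m) ≡ 0 → m ≡ n
∸+∸≡0⇒≡ {m} {n} p = ℕ.≤-antisym (ℕ.m∸n≡0⇒m≤n (ℕ.m+n≡0⇒m≡0 (m ∸ n) p))
                              (ℕ.m∸n≡0⇒m≤n (ℕ.m+n≡0⇒n≡0 (m ∸ n) p))

n∸n+n∸n≡0 : ∀ n → (n ∸ n) ℕ.+ (n ∸ n) ≡ 0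
n∸n+n∸n≡0 n = cong₂ ℕ._+_ (ℕ.n∸n≡0 n) (ℕ.n∸n≡0 n)

-- An incoming edge at s would be traversed in the wrong direction, so that side is excluded.
data Departing : ∀ {mode} → Side mode → Set where
  incident : Departing incident
  outgoing : Departing outgoing

module _ {n m : ℕ} where

  edgeAt-joins : ∀ {mode} (G : Structure mode n m) {k : Side mode} → Departing k → ∀ v j →
                 let (e , u) = edgeAt G k v j in Joins mode G e v u
  edgeAt-joins G incident v j =
    proj₂ (Inverse.to ends (v , j)) , cong proj₁ (Inverse.strictlyInverseʳ ends (v , j)) , refl
    where open Undirected G
  edgeAt-joins G outgoing v j = cong proj₁ (Inverse.strictlyInverseʳ (Directed.outs G) (v , j)) , refl

module Shortcut (R : Reals) {mode : Mode} (k : Side mode) (dep : Departing k)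
                (j : ℕ) (ν : Reals.ℝ R) (A : Program R mode) where

  open Reals R hiding (zero; refl)
  open RealProperties R
  open Relocation R {mode}

  -- If s ≠ t and the j-th edge of s is an edge to t of weight at most ν, it is
  -- output; every failed test jumps to 18, where the registers are reset for A.
  probe : Program R mode
  probe =
    opℕ monus 3 1 2 ∷
    opℕ monus 4 2 1 ∷
    opℕ plus 3 3 4 ∷
    jumpIf0 3 18 ∷
    degreeQ k 3 1 ∷
    setℕ 4 j ∷
    opℕ monus 3 3 4 ∷
    jumpIf0 3 18 ∷
    edgeQ k 1 4 3 5 0 ∷
    setℝ 1 ν ∷
    jumpIf< 1 0 18 ∷
    opℕ monus 6 2 5 ∷
    opℕ monus 5 5 2 ∷
    opℕ plus 5 5 6 ∷
    jumpIf0 5 16 ∷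
    jump 18 ∷
    emit 3 ∷
    halt ∷
    setℕ 3 0 ∷
    setℕ 4 0 ∷
    setℕ 5 0 ∷
    setℕ 6 0 ∷
    setℝ 0 0# ∷
    setℝ 1 0# ∷
    []

  shortcut : Program R mode
  shortcut = prepend probe A

  module _ (x : Input R mode) where

    open Input x
    open Runs R x shortcut

    private
      if-true : ∀ {b} {c d : Config R} → b ≡ true → goto R (if b then c else d) ≡ goto R c
      if-true refl = refl

      if-false : ∀ {b} {c d : Config R} → b ≡ false → goto R (if b then c else d) ≡ goto R d
      if-false refl = refl

      found : ∀ {A B : Set} {f : A → B} {b : B} {m : Maybe A} {a} → m ≡ just a → maybe′ f b m ≡ f a
      found refl = refl

      found₂ : ∀ {B : Set} {f : ∀ v → Fin (sideDegree graph k v) → B} {b : B} {mv v i} →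
               mv ≡ just v → toFin (sideDegree graph k v) j ≡ just i →
               maybe′ (λ v → maybe′ (f v) b (toFin (sideDegree graph k v) j)) b mv ≡ f v i
      found₂ refl p rewrite p = refl

    -- Once a shifted copy of the initial configuration is reached, A is reproduced exactly; how
    -- many steps the detour took does not affect the limit probability.
    FallsBack : Set
    FallsBack = ∃[ n ] ∃[ d ] (initial R x ⟶⟨ n ⟩ d × Shifted (length probe) (initial R x) d)

    -- Positions 18 to 23 clear natural registers 3 to 6 and real registers 0 and 1, the only ones
    -- the probe writes. The hypotheses say that all others still hold their initial contents.
    reset : ∀ {n} nat rea → initial R x ⟶⟨ n ⟩ record { pc = 18 ; nat = nat ; rea = rea ; out = [] } →
            nat 0 ≡ #V → nat 1 ≡ toℕ s → nat 2 ≡ toℕ t → (∀ i → nat (7 ℕ.+ i) ≡ 0) →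
            (∀ i → rea (2 ℕ.+ i) ≡ 0#) → FallsBack
    reset nat rea run n₀ n₁ n₂ n₇ r₂ =
      _ , _ , run ⊕ (refl ∷ refl ∷ refl ∷ refl ∷ refl ∷ refl ∷ []) ,
      shifted refl nat≗ rea≗ refl
      where
      nat≗ : ∀ i → Config.nat (initial R x) i ≡
                   update 6 0 (update 5 0 (update 4 0 (update 3 0 nat))) i
      nat≗ 0 = ≡.sym n₀
      nat≗ 1 = ≡.sym n₁
      nat≗ 2 = ≡.sym n₂
      nat≗ 3 = refl
      nat≗ 4 = refl
      nat≗ 5 = refl
      nat≗ 6 = refl
      nat≗ (suc (suc (suc (suc (suc (suc (suc i))))))) = ≡.sym (n₇ i)
      rea≗ : ∀ i → Config.rea (initial R x) i ≡ update 1 0# (update 0 0# rea) i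
      rea≗ 0 = refl
      rea≗ 1 = refl
      rea≗ (suc (suc i)) = ≡.sym (r₂ i)

    private
      nat₄ : ℕ → ℕ
      nat₄ = update 3 ((toℕ s ∸ toℕ t) ℕ.+ (toℕ t ∸ toℕ s)) (update 4 (toℕ t ∸ toℕ s)
               (update 3 (toℕ s ∸ toℕ t) (Config.nat (initial R x))))

      c₃ : Config R
      c₃ = record { pc = 3 ; nat = nat₄ ; rea = λ _ → 0# ; out = [] }

      compare-ends : initial R x ⟶⟨ 3 ⟩ c₃
      compare-ends = refl ∷ refl ∷ refl ∷ []

    s≡t-fallsBack : s ≡ t → FallsBack
    s≡t-fallsBack s≡t = reset nat₄ _ (compare-ends ⊕ (if-true (≡ᵇ0-true equal) ∷ []))
      refl refl refl (λ _ → refl) (λ _ → refl)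
      where
      equal : (toℕ s ∸ toℕ t) ℕ.+ (toℕ t ∸ toℕ s) ≡ 0
      equal rewrite s≡t = n∸n+n∸n≡0 (toℕ t)

    module _ (s≢t : s ≢ t) where

      private
        nat₇ : ℕ → ℕ
        nat₇ = update 3 (sideDegree graph k s ∸ j) (update 4 j (update 3 (sideDegree graph k s) nat₄))

        c₇ : Config R
        c₇ = record { pc = 7 ; nat = nat₇ ; rea = λ _ → 0# ; out = [] }

        compare-degree : initial R x ⟶⟨ 7 ⟩ c₇
        compare-degree = compare-ends ⊕
          (if-false (≡ᵇ0-false (s≢t ∘ Fin.toℕ-injective ∘ ∸+∸≡0⇒≡)) ∷ found (toFin-toℕ s) ∷ refl ∷ refl ∷ [])

      -- The degree is tested first because an edge query beyond it would terminate without an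
      -- output.
      j≥deg-fallsBack : sideDegree graph k s ℕ.≤ j → FallsBack
      j≥deg-fallsBack deg≤j = reset nat₇ _
        (compare-degree ⊕ (if-true (≡ᵇ0-true (ℕ.m≤n⇒m∸n≡0 deg≤j)) ∷ []))
        refl refl refl (λ _ → refl) (λ _ → refl)

      module _ (j′ : Fin (sideDegree graph k s)) (j′≡j : toℕ j′ ≡ j) where

        private
          e = proj₁ (edgeAt graph k s j′)
          u = proj₂ (edgeAt graph k s j′)

          j<deg : j ℕ.< sideDegree graph k s
          j<deg = subst (ℕ._< sideDegree graph k s) j′≡j (Fin.toℕ<n j′)

          nat₁₀ : ℕ → ℕ
          nat₁₀ = update 5 (toℕ u) (update 3 (toℕ e) nat₇)

          rea₁₀ : ℕ → ℝ
          rea₁₀ = update 1 ν (update 0 (weight e) (λ _ → 0#))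

          c₁₀ : Config R
          c₁₀ = record { pc = 10 ; nat = nat₁₀ ; rea = rea₁₀ ; out = [] }

          query-edge : initial R x ⟶⟨ 10 ⟩ c₁₀
          query-edge = compare-degree ⊕
            (if-false (≡ᵇ0-false (ℕ.<⇒≱ j<deg ∘ ℕ.m∸n≡0⇒m≤n)) ∷
             found₂ (toFin-toℕ s) (toFin-just j′ j′≡j) ∷ refl ∷ [])

        heavy-fallsBack : ν < weight e → FallsBack
        heavy-fallsBack ν<w = reset nat₁₀ rea₁₀
          (query-edge ⊕ (if-true (dec-true (ν <? weight e) ν<w) ∷ []))
          refl refl refl (λ _ → refl) (λ _ → refl)

        module _ (ν≮w : ¬ (ν < weight e)) where

          private
            nat₁₄ : ℕ → ℕ
            nat₁₄ = update 5 ((toℕ u ∸ toℕ t) ℕ.+ (toℕ t ∸ toℕ u)) (update 5 (toℕ u ∸ toℕ t)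
                      (update 6 (toℕ t ∸ toℕ u) nat₁₀))

            c₁₄ : Config R
            c₁₄ = record { pc = 14 ; nat = nat₁₄ ; rea = rea₁₀ ; out = [] }

            compare-target : initial R x ⟶⟨ 14 ⟩ c₁₄
            compare-target = query-edge ⊕
              (if-false (dec-false (ν <? weight e) ν≮w) ∷ refl ∷ refl ∷ refl ∷ [])

          u≢t-fallsBack : u ≢ t → FallsBack
          u≢t-fallsBack u≢t = reset nat₁₄ rea₁₀
            (compare-target ⊕ (if-false (≡ᵇ0-false (u≢t ∘ Fin.toℕ-injective ∘ ∸+∸≡0⇒≡)) ∷ refl ∷ []))
            refl refl refl (λ _ → refl) (λ _ → refl)

          answers : u ≡ t → ∃[ d ] (initial R x ⟶⟨ 16 ⟩ d ×
                    step R x shortcut d ≡ stop (just (path (toℕ e ∷ []))))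
          answers u≡t = _ , compare-target ⊕ (if-true (≡ᵇ0-true equal) ∷ refl ∷ []) , refl
            where
            equal : (toℕ u ∸ toℕ t) ℕ.+ (toℕ t ∸ toℕ u) ≡ 0
            equal rewrite u≡t = n∸n+n∸n≡0 (toℕ t)


    -- The probe takes a fixed number n of steps without randomness, so what A achieves within N
    -- steps is achieved within n + N.
    succeeds-via-fallback : FallsBack → ∀ {p} → SucceedsWithProbability≥ R x A p →
                            SucceedsWithProbability≥ R x shortcut p
    succeeds-via-fallback (n , d , run , sh) (correct? , hA) = correct? , λ q q<p →
      let (N , q<P) = hA q q<p in
      n ℕ.+ N , <-respʳ-≈ (trans (probWithin-prepend x probe A correct? N sh)
                                 (sym (probWithin-⟶ correct? run N))) q<P

    -- The bound 17 counts the 16 steps up to and including `emit`, and `halt`.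
    costWithin-answers : s ≢ t → (j′ : Fin (sideDegree graph k s)) → toℕ j′ ≡ j →
                         ¬ (ν < weight (proj₁ (edgeAt graph k s j′))) →
                         proj₂ (edgeAt graph k s j′) ≡ t → ∀ μ → ExpectedCost≤ R x shortcut μ (fromℕ 17)
    costWithin-answers s≢t j′ j′≡j ν≮w u≡t μ N =
      let (d , run , halted) = answers s≢t j′ j′≡j ν≮w u≡t in costWithin-⟶-stop μ run halted N

    module _ (0≤ν : 0# ≤ ν) (ν≤weight : ∀ e → ν ≤ weight e) where

      -- Because s ≠ t, every competing path has a first edge, which alone weighs at least ν. This
      -- is where the minimality of ν enters.
      edge-shortest : s ≢ t → ∀ e → Joins mode graph e s t → weight e ≤ ν → Correct R x (path (toℕ e ∷ []))
      edge-shortest s≢t e e-joins w≤ν =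
        e ∷ [] , refl , (s ∷ t ∷ [] , move e e-joins stay , (s≢t ∷ []) ∷ [] ∷ []) , shortest
        where
        0≤length : ∀ es → 0# ≤ pathLength R x es
        0≤length []       = ≤-refl
        0≤length (e ∷ es) = 0≤x+y (≤-trans 0≤ν (ν≤weight e)) (0≤length es)

        shortest : ∀ es → IsPath mode graph s t es → pathLength R x (e ∷ []) ≤ pathLength R x es
        shortest []        (_ , stay , _) = contradiction refl s≢t
        shortest (e′ ∷ es) _ = +-mono-≤ (≤-trans w≤ν (ν≤weight e′)) (0≤length es)

      shortcut-succeeds : ∀ {p} → p ≤ 1# → SucceedsWithProbability≥ R x A p →
                          SucceedsWithProbability≥ R x shortcut p
      shortcut-succeeds p≤1 hA with s Fin.≟ t
      ... | yes s≡t = succeeds-via-fallback (s≡t-fallsBack s≡t) hA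
      ... | no s≢t with j ℕ.<? sideDegree graph k s
      ...   | no j≮deg = succeeds-via-fallback (j≥deg-fallsBack s≢t (ℕ.≮⇒≥ j≮deg)) hA
      ...   | yes j<deg = go (fromℕ< j<deg) (Fin.toℕ-fromℕ< j<deg)
        where
        go : ∀ j′ → toℕ j′ ≡ j → SucceedsWithProbability≥ R x shortcut _
        go j′ j′≡j with ν <? weight (proj₁ (edgeAt graph k s j′))
        ... | yes ν<w = succeeds-via-fallback (heavy-fallsBack s≢t j′ j′≡j ν<w) hA
        ... | no ν≮w with proj₂ (edgeAt graph k s j′) Fin.≟ t
        ...   | no u≢t = succeeds-via-fallback (u≢t-fallsBack s≢t j′ j′≡j ν≮w u≢t) hA
        ...   | yes u≡t = correct? , λ q q<p → 17 , (begin-strict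
            q     <⟨ q<p ⟩
            _     ≤⟨ p≤1 ⟩
            1#    ≈⟨ certain ⟨
            probWithin R x shortcut correct? 1 d  ≈⟨ probWithin-⟶ correct? run 1 ⟨
            probWithin R x shortcut correct? 17 (initial R x) ∎)
          where
          open Reasoning
          -- Correctness of an output depends on the input and not on the program, so the decision
          -- procedure that comes with A serves here too.
          correct? = proj₁ hA
          e = proj₁ (edgeAt graph k s j′)
          d = proj₁ (answers s≢t j′ j′≡j ν≮w u≡t)
          run = proj₁ (proj₂ (answers s≢t j′ j′≡j ν≮w u≡t))
          halted = proj₂ (proj₂ (answers s≢t j′ j′≡j ν≮w u≡t))
          correct : Correct R x (path (toℕ e ∷ []))
          correct = edge-shortest s≢t e
            (subst (Joins mode graph e s) u≡t (edgeAt-joins graph dep s j′)) (≮⇒≥ ν≮w)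
          certain : probWithin R x shortcut correct? 1 d ≈ 1#
          certain rewrite halted | dec-true (correct? (path (toℕ e ∷ []))) correct = Reals.refl R

-- The graphs on two vertices

-- remQuot unfolds to a composition, which gets in the way of rewriting.
opaque

  locate : ∀ m n → Fin (m ℕ.* n) → Fin m × Fin n
  locate m n = remQuot {m} n

  locate-combine : ∀ {m n} (i : Fin m) (j : Fin n) → locate m n (combine i j) ≡ (i , j)
  locate-combine = Fin.remQuot-combine

  combine-locate : ∀ m n (e : Fin (m ℕ.* n)) →
                   combine (proj₁ (locate m n e)) (proj₂ (locate m n e)) ≡ e
  combine-locate m n = Fin.combine-remQuot {m} n

-- An action of the group of order two on the vertices; being involutive, it serves in both
-- directions of the incidence bijections.
cross : Bool → Fin 2 → Fin 2
cross false v          = v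
cross true  zero       = suc zero
cross true  (suc zero) = zero

cross-involutive : ∀ b v → cross b (cross b v) ≡ v
cross-involutive false v          = refl
cross-involutive true  zero       = refl
cross-involutive true  (suc zero) = refl

side : ∀ mode → Side mode
side undirected = incident
side directed   = outgoing

side-departing : ∀ mode → Departing (side mode)
side-departing undirected = incident
side-departing directed   = outgoing

private
  bit : Fin 2 → Bool
  bit zero       = false
  bit (suc zero) = true

  index : Bool → Fin 2
  index false = zero
  index true  = suc zero

  bit-index : ∀ b → bit (index b) ≡ b
  bit-index false = refl
  bit-index true  = refl

  index-bit : ∀ i → index (bit i) ≡ i
  index-bit zero       = refl
  index-bit (suc zero) = refl

-- Edge (v , j) leaves vertex v and returns to v, except that it ends at the
-- other vertex when h j holds.  So (0 , j) and (1 , j) are either two loops or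
-- two parallel (antiparallel, if directed) edges between the vertices, and the
-- incidence lists differ only at the positions of block j.

module _ {M : ℕ} (h : Fin M → Bool) where

  undirectedLoops : Undirected 2 (2 ℕ.* M)
  undirectedLoops = record { deg = λ _ → M ℕ.* 2 ; ends = mk↔ₛ′ to from to∘from from∘to }
    where
    -- Position 2j + i holds end i of an edge of block j. End 0 never moves; the two ends 1 of the
    -- block trade vertices when `h j` holds.
    to : Σ (Fin 2) (λ _ → Fin (M ℕ.* 2)) → Fin (2 ℕ.* M) × Bool
    to (v , p) = let (j , i) = locate M 2 p in combine (cross (h j ∧ bit i) v) j , bit i

    from : Fin (2 ℕ.* M) × Bool → Σ (Fin 2) (λ _ → Fin (M ℕ.* 2))
    from (e , b) = let (v , j) = locate 2 M e in cross (h j ∧ b) v , combine j (index b)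

    to∘from : ∀ y → to (from y) ≡ y
    to∘from (e , b)
      rewrite locate-combine (proj₂ (locate 2 M e)) (index b)
            | bit-index b
            | cross-involutive (h (proj₂ (locate 2 M e)) ∧ b) (proj₁ (locate 2 M e))
            | combine-locate 2 M e
      = refl

    from∘to : ∀ y → from (to y) ≡ y
    from∘to (v , p)
      rewrite locate-combine
                (cross (h (proj₁ (locate M 2 p)) ∧ bit (proj₂ (locate M 2 p))) v)
                (proj₁ (locate M 2 p))
            | cross-involutive (h (proj₁ (locate M 2 p)) ∧ bit (proj₂ (locate M 2 p))) v
            | index-bit (proj₂ (locate M 2 p))
            | combine-locate M 2 p
      = refl

  directedLoops : Directed 2 (2 ℕ.* M)
  directedLoops = record
    { outdeg = λ _ → M
    ; indeg  = λ _ → M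
    ; outs   = mk↔ₛ′ (λ (v , j) → combine v j) (locate 2 M)
                 (combine-locate 2 M) (λ (v , j) → locate-combine v j)
    ; ins    = mk↔ₛ′ to from to∘from from∘to
    }
    where
    to : Σ (Fin 2) (λ _ → Fin M) → Fin (2 ℕ.* M)
    to (v , j) = combine (cross (h j) v) j

    from : Fin (2 ℕ.* M) → Σ (Fin 2) (λ _ → Fin M)
    from e = let (v , j) = locate 2 M e in cross (h j) v , j

    to∘from : ∀ e → to (from e) ≡ e
    to∘from e rewrite cross-involutive (h (proj₂ (locate 2 M e))) (proj₁ (locate 2 M e)) =
      combine-locate 2 M e

    from∘to : ∀ y → from (to y) ≡ y
    from∘to (v , j) rewrite locate-combine (cross (h j) v) j | cross-involutive (h j) v = refl

  loops : ∀ mode → Structure mode 2 (2 ℕ.* M)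
  loops undirected = undirectedLoops
  loops directed   = directedLoops

  loops-degree : ∀ mode v → degree mode (loops mode) v ℕ.≤ M ℕ.* 2
  loops-degree undirected v = ℕ.≤-refl
  loops-degree directed   v = ℕ.≤-reflexive (≡.trans (cong (M ℕ.+_) (≡.sym (ℕ.+-identityʳ M))) (ℕ.*-comm 2 M))

  -- This is where the competitor looks. In the undirected case it is end 0 of edge (v , j), so the
  -- answer names the vertex holding end 1.
  position : ∀ mode v → Fin M → Fin (sideDegree (loops mode) (side mode) v)
  position undirected v j = combine j zero
  position directed   v j = j

  edgeAt-position : ∀ mode v j → edgeAt (loops mode) (side mode) v (position mode v j)
                                   ≡ (combine v j , cross (h j) v)
  edgeAt-position undirected v j
    rewrite locate-combine j (zero {1})
          | Bool.∧-zeroʳ (h j)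
          | locate-combine v j
          | Bool.∧-identityʳ (h j)
    = refl
  edgeAt-position directed v j rewrite locate-combine v j = refl

-- Indistinguishability away from the crossed block

-- The answer to an edge query depends on `h` only at the block of its position, whichever vertex is
-- asked. So one query informs about at most one block.
block : ∀ {mode} M → Side mode → ℕ → Maybe (Fin M)
block M incident p = Maybe.map (proj₁ ∘ locate M 2) (toFin (M ℕ.* 2) p)
block M outgoing p = toFin M p
block M incoming p = toFin M p

uncrossed : ∀ {M} → Fin M → Bool
uncrossed _ = false

crossedAt : ∀ {M} → Fin M → Fin M → Bool
crossedAt k j = does (j Fin.≟ k)

edgeAt-undirected : ∀ {M} (h : Fin M → Bool) v p → h (proj₁ (locate M 2 p)) ≡ false →
                    edgeAt (undirectedLoops h) incident v p ≡ edgeAt (undirectedLoops {M} uncrossed) incident v p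
edgeAt-undirected {M} h v p hj≡false
  -- The value of `h` is consulted twice, for the edge at the position and for its other end; the
  -- second occurrence surfaces only after that edge has been located.
  rewrite hj≡false | locate-combine v (proj₁ (locate M 2 p)) | hj≡false = refl

edgeAt-outgoing : ∀ {M} (h : Fin M → Bool) v j → h j ≡ false →
                  edgeAt (directedLoops h) outgoing v j ≡ edgeAt (directedLoops {M} uncrossed) outgoing v j
edgeAt-outgoing {M} h v j hj≡false rewrite locate-combine v j | hj≡false = refl

edgeAt-incoming : ∀ {M} (h : Fin M → Bool) v j → h j ≡ false →
                  edgeAt (directedLoops h) incoming v j ≡ edgeAt (directedLoops {M} uncrossed) incoming v j
edgeAt-incoming {M} h v j hj≡false rewrite hj≡false = refl

uncrossed-joins : ∀ {M} mode {e u v} → Joins mode (loops {M} uncrossed mode) e u v → u ≡ v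
uncrossed-joins undirected (b , refl , refl) = refl
uncrossed-joins directed   (refl , refl)     = refl

uncrossed-walk : ∀ {M} mode {u v vs es} → Walk mode (loops {M} uncrossed mode) u v vs es → u ≡ v
uncrossed-walk mode stay           = refl
uncrossed-walk mode (move e e-joins w) = ≡.trans (uncrossed-joins mode e-joins) (uncrossed-walk mode w)

module Instances (R : Reals) (mode : Mode) (M : ℕ) (ν : Reals.ℝ R) where

  open Reals R hiding (zero; refl)

  instanceOf : (Fin M → Bool) → Input R mode
  instanceOf h = record { graph = loops h mode ; weight = λ _ → ν ; s = zero ; t = suc zero }

  base : Input R mode
  base = instanceOf uncrossed

  variant : Fin M → Input R mode
  variant k = instanceOf (crossedAt k)

  instanceOf-inClass : ∀ {W : Pred ℝ 0ℓ} → W ν → ∀ h → InClass R W (M ℕ.* 2) (instanceOf h)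
  instanceOf-inClass Wν h = (λ _ → Wν) , loops-degree h mode

  uncrossed-unreachable : ∀ {ns} → ¬ Correct R (instanceOf uncrossed) (path ns)
  uncrossed-unreachable (_ , _ , (_ , walk , _) , _) with uncrossed-walk mode walk
  ... | ()

  edgeAt-crossed : ∀ k → edgeAt (loops (crossedAt k) mode) (side mode) zero (position (crossedAt k) mode zero k)
                         ≡ (combine {2} {M} zero k , suc zero)
  edgeAt-crossed k = ≡.trans (edgeAt-position (crossedAt k) mode zero k)
    (cong (λ b → combine {2} {M} zero k , cross b zero) (dec-true (k Fin.≟ k) refl))

  crossed-reachable : ∀ k → ¬ Correct R (instanceOf (crossedAt k)) unreachable
  crossed-reachable k no-path = no-path
    (_ , zero ∷ suc zero ∷ [] , move _ e-joins stay , ((λ ()) ∷ []) ∷ [] ∷ [])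
    where
    G = loops (crossedAt k) mode
    p = position (crossedAt k) mode zero k
    e-joins : Joins mode G (proj₁ (edgeAt G (side mode) zero p)) zero (suc zero)
    e-joins = subst (Joins mode G _ zero) (cong proj₂ (edgeAt-crossed k)) (edgeAt-joins G (side-departing mode) zero p)

  -- Degrees do not depend on `h`, so degree queries touch nothing. A query at an invalid vertex may
  -- be counted as well, which is harmless since it has the same cost.
  touched : Config R → Instr R mode → Maybe (Fin M)
  touched c (edgeQ k v j e u w) = block M k (Config.nat c j)
  touched c _                   = nothing

  -- The lower bound counts touching queries only, and these cost 1 under both measures; so query
  -- and time complexity are treated together.
  touched-cost : ∀ μ c i {j} → touched c i ≡ just j → cost R μ i ≡ 1
  touched-cost queries c (edgeQ _ _ _ _ _ _) _ = refl
  touched-cost time    c i                   _ = refl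

  private
    -- All weights are ν, so the effect of a valid edge query is a function of the edge found and
    -- its other end alone.
    answer : Config R → (e u w : ℕ) → Fin (2 ℕ.* M) × Fin 2 → Step R
    answer c e u w (e′ , u′) = goto R (record
      { pc  = suc (Config.pc c)
      ; nat = update u (toℕ u′) (update e (toℕ e′) (Config.nat c))
      ; rea = update w ν (Config.rea c)
      ; out = Config.out c
      })

  execute-agree : ∀ h c i → (∀ j → touched c i ≡ just j → h j ≡ false) →
                  execute R (instanceOf h) c i ≡ execute R (instanceOf uncrossed) c i
  execute-agree h c (setℕ i a)      _ = refl
  execute-agree h c (opℕ o i j k)   _ = refl
  execute-agree h c (loadℕ i j)     _ = refl
  execute-agree h c (storeℕ i j)    _ = refl
  execute-agree h c (setℝ i a)      _ = refl
  execute-agree h c (opℝ o i j k)   _ = refl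
  execute-agree h c (loadℝ i j)     _ = refl
  execute-agree h c (storeℝ i j)    _ = refl
  execute-agree h c (jump l)        _ = refl
  execute-agree h c (jumpIf0 i l)   _ = refl
  execute-agree h c (jumpIf< i j l) _ = refl
  execute-agree h c (random i j)    _ = refl
  execute-agree h c (degreeQ incident i v) _ = refl
  execute-agree h c (degreeQ outgoing i v) _ = refl
  execute-agree h c (degreeQ incoming i v) _ = refl
  execute-agree h c (edgeQ incident v j e u w) untouched with toFin 2 (Config.nat c v)
  ... | nothing = refl
  ... | just v′ with toFin (M ℕ.* 2) (Config.nat c j)
  ...   | nothing = refl
  ...   | just p = cong (answer c e u w) (edgeAt-undirected h v′ p (untouched _ refl))
  execute-agree h c (edgeQ outgoing v j e u w) untouched with toFin 2 (Config.nat c v)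
  ... | nothing = refl
  ... | just v′ with toFin M (Config.nat c j)
  ...   | nothing = refl
  ...   | just p = cong (answer c e u w) (edgeAt-outgoing h v′ p (untouched p refl))
  execute-agree h c (edgeQ incoming v j e u w) untouched with toFin 2 (Config.nat c v)
  ... | nothing = refl
  ... | just v′ with toFin M (Config.nat c j)
  ...   | nothing = refl
  ...   | just p = cong (answer c e u w) (edgeAt-incoming h v′ p (untouched p refl))
  execute-agree h c (emit i)        _ = refl
  execute-agree h c halt            _ = refl
  execute-agree h c reject          _ = refl

-- The averaging argument over the crossed block

module LowerBound (R : Reals) (mode : Mode) (M : ℕ) (ν : Reals.ℝ R)
                  (μ : Measure) (A : Program R mode) where

  open Reals R hiding (zero; refl)
  open RealProperties R
  open Instances R mode M ν

  private
    touching : Config R → Maybe (Fin M)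
    touching c = maybe′ (touched c) nothing (fetch R base A c)

    step-agree : ∀ k c → (∀ j → touching c ≡ just j → j ≢ k) →
                 step R (variant k) A c ≡ step R base A c
    step-agree k c k-untouched with fetch R base A c
    ... | nothing = refl
    ... | just i  = execute-agree (crossedAt k) c i (λ j h → dec-false (j Fin.≟ k) (k-untouched j h))

    touching-cost : ∀ x c {j} → touching c ≡ just j → stepCost R {mode} x A μ c ≡ fromℕ 1
    touching-cost x c h with fetch R base A c
    ... | just i = cong fromℕ (touched-cost μ c i h)

  indicator : ∀ {m} → Fin m → Fin m → ℝ
  indicator j k = if does (j Fin.≟ k) then 1# else 0#

  sum-indicator : ∀ {m} (j : Fin m) → sum (indicator j) ≈ 1#
  sum-indicator {suc m} zero    = trans (+-congˡ (trans (sum-const m 0#) (zeroʳ _))) (+-identityʳ 1#)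
  sum-indicator {suc m} (suc j) = trans (+-identityˡ _) (sum-indicator j)

  0≤indicator : ∀ {m} (j k : Fin m) → 0# ≤ indicator j k
  0≤indicator j k with does (j Fin.≟ k)
  ... | true  = 0≤1
  ... | false = ≤-refl

  mutual
    -- Expected number of visits to block k among the first q edge queries made
    -- on the uncrossed instance within N steps.
    touches : Fin M → ℕ → ℕ → Config R → ℝ
    touches k zero    q c = 0#
    touches k (suc N) q c = touchesNow k N q (touching c) (step R base A c)

    touchesNow : Fin M → ℕ → ℕ → Maybe (Fin M) → Step R → ℝ
    touchesNow k N q       nothing  s = touchesAfter k N q s
    touchesNow k N zero    (just j) s = 0#
    touchesNow k N (suc q) (just j) s = indicator j k + touchesAfter k N q s

    touchesAfter : Fin M → ℕ → ℕ → Step R → ℝ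
    touchesAfter k N q (stop _)   = 0#
    touchesAfter k N q (branch c) = mean (λ i → touches k N q (c i))

  mutual
    0≤touches : ∀ k N q c → 0# ≤ touches k N q c
    0≤touches k zero    q c = ≤-refl
    0≤touches k (suc N) q c = 0≤touchesNow k N q (touching c) (step R base A c)

    0≤touchesNow : ∀ k N q b s → 0# ≤ touchesNow k N q b s
    0≤touchesNow k N q       nothing  s = 0≤touchesAfter k N q s
    0≤touchesNow k N zero    (just j) s = ≤-refl
    0≤touchesNow k N (suc q) (just j) s = 0≤x+y (0≤indicator j k) (0≤touchesAfter k N q s)

    0≤touchesAfter : ∀ k N q s → 0# ≤ touchesAfter k N q s
    0≤touchesAfter k N q (stop _)   = ≤-refl
    0≤touchesAfter k N q (branch c) = ≤mean (λ i → 0≤touches k N q (c i))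

  private
    sum-zero : ∀ q → sum {M} (λ _ → 0#) ≤ fromℕ q
    sum-zero q = ≤-trans (≤-reflexive (trans (sum-const M 0#) (zeroʳ _))) (0≤fromℕ q)

  mutual
    -- Each counted query adds 1 at a single block and at most q are counted. The bound holds on
    -- every branch, so it survives averaging, and it does not grow with N.
    sum-touches : ∀ N q c → sum (λ k → touches k N q c) ≤ fromℕ q
    sum-touches zero    q c = sum-zero q
    sum-touches (suc N) q c = sum-touchesNow N q (touching c) (step R base A c)

    sum-touchesNow : ∀ N q b s → sum (λ k → touchesNow k N q b s) ≤ fromℕ q
    sum-touchesNow N q       nothing  s = sum-touchesAfter N q s
    sum-touchesNow N zero    (just j) s = sum-zero zero
    sum-touchesNow N (suc q) (just j) s = begin
      sum (λ k → indicator j k + touchesAfter k N q s)     ≈⟨ sum-+ (indicator j) _ ⟩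
      sum (indicator j) + sum (λ k → touchesAfter k N q s) ≤⟨ +-mono-≤ (≤-reflexive (sum-indicator j)) (sum-touchesAfter N q s) ⟩
      1# + fromℕ q                                         ∎
      where open Reasoning

    sum-touchesAfter : ∀ N q s → sum (λ k → touchesAfter k N q s) ≤ fromℕ q
    sum-touchesAfter N q (stop _)   = sum-zero q
    sum-touchesAfter N q (branch c) =
      ≤-trans (≤-reflexive (sym (mean-sum (λ k i → touches k N q (c i)))))
              (mean≤ (λ i → sum-touches N q (c i)))

  module _ (k : Fin M) (variant? : Decidable (Correct R (variant k))) (base? : Decidable (Correct R base))
           {Q : ℝ} (0≤Q : 0# ≤ Q) where

    private
      module V = Runs R (variant k) A
      module B = Runs R base A

      success : ℕ → Config R → ℝ
      success N c = probWithin R (variant k) A variant? N c + probWithin R base A base? N c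

      successAfter : ℕ → Step R → Step R → ℝ
      successAfter N s s′ = probWithinAfter R (variant k) A variant? N s + probWithinAfter R base A base? N s′

      successAfter≤2 : ∀ N s s′ → Q * successAfter N s s′ ≤ Q + Q
      successAfter≤2 N s s′ = begin
        Q * successAfter N s s′ ≤⟨ *-monoˡ-≤ 0≤Q (+-mono-≤ (V.probWithinAfter≤1 variant? N s) (B.probWithinAfter≤1 base? N s′)) ⟩
        Q * (1# + 1#)           ≈⟨ distribˡ Q 1# 1# ⟩
        Q * 1# + Q * 1#         ≈⟨ +-cong (*-identityʳ Q) (*-identityʳ Q) ⟩
        Q + Q                   ∎
        where open Reasoning

      -- No output is correct both on the variant and on the base instance.
      exclusive : ∀ N s → (∀ {j} {c : Fin (suc j) → Config R} → s ≢ branch c) → successAfter N s s ≤ 1#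
      exclusive N (branch c) h = contradiction refl h
      exclusive N (stop nothing) _ = ≤-trans (≤-reflexive (+-identityˡ 0#)) 0≤1
      exclusive N (stop (just (path ns))) _
        rewrite dec-false (base? (path ns)) uncrossed-unreachable =
          ≤-trans (≤-reflexive (+-identityʳ _)) (V.probWithinAfter≤1 variant? N (stop (just (path ns))))
      exclusive N (stop (just unreachable)) _
        rewrite dec-false (variant? unreachable) (crossed-reachable k) =
          ≤-trans (≤-reflexive (+-identityˡ _)) (B.probWithinAfter≤1 base? N (stop (just unreachable)))

      0≤rest : ∀ {a b} → 0# ≤ a → 0# ≤ b → 0# ≤ Q * a + b
      0≤rest 0≤a 0≤b = 0≤x+y (0≤x*y 0≤Q 0≤a) 0≤b

      stopped : ∀ N q s D → Q ≤ D → (∀ {j} {c : Fin (suc j) → Config R} → s ≢ branch c) →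
                Q * successAfter N s s ≤
                (Q * touchesAfter k N q s + costWithinAfter R (variant k) A μ N s) + D
      stopped N q s D Q≤D h = begin
        Q * successAfter N s s ≤⟨ *-monoˡ-≤ 0≤Q (exclusive N s h) ⟩
        Q * 1#                 ≈⟨ *-identityʳ Q ⟩
        Q                      ≤⟨ Q≤D ⟩
        D                      ≤⟨ y≤x+y D (0≤rest (0≤touchesAfter k N q s) (V.0≤costWithinAfter μ N s)) ⟩
        _                      ∎
        where open Reasoning

    mutual
      -- Until block k is touched, the runs on the two instances agree, so they
      -- cannot both succeed.  D − Q is the number of queries already made, and
      -- q is what remains of a budget of Q queries.
      success-bound : ∀ N q c D → Q ≤ D → Q + Q ≤ fromℕ q + D →
                      Q * success N c ≤
                      (Q * touches k N q c + costWithin R (variant k) A μ N c) + D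
      success-bound zero q c D Q≤D _ = begin
        Q * (0# + 0#)       ≈⟨ *-congˡ (+-identityˡ 0#) ⟩
        Q * 0#              ≈⟨ zeroʳ Q ⟩
        0#                  ≤⟨ 0≤x+y (0≤rest ≤-refl ≤-refl) (≤-trans 0≤Q Q≤D) ⟩
        (Q * 0# + 0#) + D   ∎
        where open Reasoning
      success-bound (suc N) q c D Q≤D budget with touching c in eq
      ... | nothing rewrite step-agree k c (λ j h → contradiction (≡.trans (≡.sym eq) h) λ ()) = begin
        Q * successAfter N s s ≤⟨ success-bound-after N q s D Q≤D budget ⟩
        (Q * τ + C) + D        ≤⟨ +-monoˡ-≤ D (+-monoʳ-≤ (Q * τ) (y≤x+y C (V.0≤stepCost μ c))) ⟩
        _                      ∎
        where
        open Reasoning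
        s = step R base A c
        τ = touchesAfter k N q s
        C = costWithinAfter R (variant k) A μ N s
      -- With the budget spent, D has reached 2Q, and the trivial bound 2 on the sum of the two
      -- probabilities suffices.
      success-bound (suc N) zero c D Q≤D budget | just j = begin
        Q * success (suc N) c  ≤⟨ successAfter≤2 N (step R (variant k) A c) (step R base A c) ⟩
        Q + Q                  ≤⟨ budget ⟩
        0# + D                 ≤⟨ +-monoˡ-≤ D (0≤rest ≤-refl (V.0≤costWithin μ (suc N) c)) ⟩
        _                      ∎
        where open Reasoning
      success-bound (suc N) (suc q) c D Q≤D budget | just j with j Fin.≟ k
      -- From here on the runs may diverge. The trivial bound 2Q is paid half by this touch and half
      -- by D.
      ... | yes _ = begin
        Q * success (suc N) c    ≤⟨ successAfter≤2 N (step R (variant k) A c) (step R base A c) ⟩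
        Q + Q                    ≤⟨ +-monoʳ-≤ Q Q≤D ⟩
        Q + D                    ≈⟨ +-congʳ (*-identityʳ Q) ⟨
        Q * 1# + D               ≤⟨ +-monoˡ-≤ D (*-monoˡ-≤ 0≤Q (x≤x+y 1# (0≤touchesAfter k N q (step R base A c)))) ⟩
        Q * (1# + τ) + D         ≤⟨ +-monoˡ-≤ D (x≤x+y _ (V.0≤costWithin μ (suc N) c)) ⟩
        _                        ∎
        where
        open Reasoning
        τ = touchesAfter k N q (step R base A c)
      -- The query costs 1 on the variant too: this unit passes from the cost to D while the budget
      -- drops by one, which keeps the budget inequality intact.
      ... | no j≢k rewrite step-agree k c (λ j′ h j′≡k → j≢k (≡.trans (just-injective (≡.trans (≡.sym eq) h)) j′≡k))
                         | touching-cost (variant k) c eq = begin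
        Q * successAfter N s s        ≤⟨ success-bound-after N q s (1′ + D) (≤-trans Q≤D (y≤x+y D (0≤fromℕ 1))) budget′ ⟩
        (Q * τ + C) + (1′ + D)        ≈⟨ regroup Q τ C 1′ D ⟩
        (Q * τ + (1′ + C)) + D        ≈⟨ +-congʳ (+-congʳ (*-congˡ (+-identityˡ τ))) ⟨
        (Q * (0# + τ) + (1′ + C)) + D ∎
        where
        open Reasoning
        s  = step R base A c
        τ  = touchesAfter k N q s
        C  = costWithinAfter R (variant k) A μ N s
        1′ = fromℕ 1
        regroup : ∀ Q τ C e D → (Q * τ + C) + (e + D) ≈ (Q * τ + (e + C)) + D
        regroup = solve 5 (λ Q τ C e D → (Q :* τ :+ C) :+ (e :+ D) := (Q :* τ :+ (e :+ C)) :+ D) (Reals.refl R)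
          where open Solver
        budget′ : Q + Q ≤ fromℕ q + (1′ + D)
        budget′ = ≤-trans budget (≤-reflexive (trans (+-congʳ (trans (+-comm 1# _) (+-congˡ (sym fromℕ-1)))) (+-assoc _ _ _)))

      success-bound-after : ∀ N q s D → Q ≤ D → Q + Q ≤ fromℕ q + D →
                            Q * successAfter N s s ≤
                            (Q * touchesAfter k N q s + costWithinAfter R (variant k) A μ N s) + D
      success-bound-after N q s@(stop _) D Q≤D _ = stopped N q s D Q≤D λ ()
      success-bound-after N q (branch {m} c) D Q≤D budget = begin
        Q * (mean PV + mean PB)                     ≈⟨ *-congˡ (mean-+ PV PB) ⟨
        Q * mean (λ i → PV i + PB i)                ≈⟨ mean-* Q (λ i → PV i + PB i) ⟨
        mean (λ i → Q * (PV i + PB i))              ≤⟨ mean-mono (λ i → success-bound N q (c i) D Q≤D budget) ⟩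
        mean (λ i → (Q * τ i + C i) + D)            ≈⟨ mean-+ (λ i → Q * τ i + C i) (λ _ → D) ⟩
        mean (λ i → Q * τ i + C i) + mean {m} (λ _ → D) ≈⟨ +-cong (mean-+ (λ i → Q * τ i) C) (mean-const m D) ⟩
        (mean (λ i → Q * τ i) + mean C) + D         ≈⟨ +-congʳ (+-congʳ (mean-* Q τ)) ⟩
        (Q * mean τ + mean C) + D                   ∎
        where
        open Reasoning
        PV = λ i → probWithin R (variant k) A variant? N (c i)
        PB = λ i → probWithin R base A base? N (c i)
        τ  = λ i → touches k N q (c i)
        C  = λ i → costWithin R (variant k) A μ N (c i)

  -- A single block may be touched with certainty, but only Q touches are available to all M blocks
  -- together. Each summand starts with D = Q, where both conditions on D hold with equality.
  total-bound : (variant? : ∀ k → Decidable (Correct R (variant k))) (base? : Decidable (Correct R base)) →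
    ∀ q N c {θ F} →
    (∀ k → θ ≤ probWithin R (variant k) A (variant? k) N c) → θ ≤ probWithin R base A base? N c →
    (∀ k → costWithin R (variant k) A μ N c ≤ F) →
    fromℕ M * (fromℕ q * (θ + θ)) ≤ fromℕ q * fromℕ q + fromℕ M * F + fromℕ M * fromℕ q
  total-bound variant? base? q N c {θ} {F} θ≤PV θ≤PB C≤F = begin
    fromℕ M * (Q * (θ + θ))                  ≈⟨ sum-const M _ ⟨
    sum {M} (λ _ → Q * (θ + θ))              ≤⟨ sum-mono each ⟩
    sum (λ k → (Q * τ k + F) + Q)            ≈⟨ sum-+ (λ k → Q * τ k + F) (λ _ → Q) ⟩
    sum (λ k → Q * τ k + F) + sum {M} (λ _ → Q) ≈⟨ +-cong (sum-+ (λ k → Q * τ k) (λ _ → F)) (sum-const M Q) ⟩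
    sum (λ k → Q * τ k) + sum {M} (λ _ → F) + fromℕ M * Q ≈⟨ +-congʳ (+-cong (sum-* Q τ) (sum-const M F)) ⟩
    Q * sum τ + fromℕ M * F + fromℕ M * Q    ≤⟨ +-monoˡ-≤ _ (+-monoˡ-≤ _ (*-monoˡ-≤ (0≤fromℕ q) (sum-touches N q c))) ⟩
    Q * Q + fromℕ M * F + fromℕ M * Q        ∎
    where
    open Reasoning
    Q = fromℕ q
    τ = λ k → touches k N q c
    each : ∀ k → Q * (θ + θ) ≤ (Q * τ k + F) + Q
    each k = ≤-trans (*-monoˡ-≤ (0≤fromℕ q) (+-mono-≤ (θ≤PV k) θ≤PB))
      (≤-trans (success-bound k (variant? k) base? (0≤fromℕ q) N q c Q ≤-refl ≤-refl)
               (+-monoˡ-≤ Q (+-monoʳ-≤ (Q * τ k) (C≤F k))))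

-- Choice of the constants

-- Each variant has its own number of steps until success is likely enough; this gives one that
-- serves all of them.
upperBound : ∀ {n} (f : Fin n → ℕ) → ∃[ N ] (∀ i → f i ℕ.≤ N)
upperBound {zero}  f = 0 , λ ()
upperBound {suc n} f with upperBound (f ∘ suc)
... | N , f≤N = f zero ℕ.⊔ N , λ
  { zero    → ℕ.m≤m⊔n (f zero) N
  ; (suc i) → ℕ.≤-trans (f≤N i) (ℕ.m≤n⊔m (f zero) N)
  }

module Constants (R : Reals) where

  open Reals R hiding (zero; refl)
  open RealProperties R

  tenths : ℕ → ℝ
  tenths n = fromℕ n * fromℕ 10 ⁻¹

  10*tenths : ∀ n → fromℕ 10 * tenths n ≈ fromℕ n
  10*tenths n = begin-equality
    T * (fromℕ n * T ⁻¹) ≈⟨ solve 3 (λ t a i → t :* (a :* i) := a :* (t :* i)) (Reals.refl R) T (fromℕ n) (T ⁻¹) ⟩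
    fromℕ n * (T * T ⁻¹) ≈⟨ *-congˡ (⁻¹-inverseʳ T (>⇒≉ (0<fromℕ 9))) ⟩
    fromℕ n * 1#         ≈⟨ *-identityʳ _ ⟩
    fromℕ n              ∎
    where
    open Reasoning
    open Solver
    T = fromℕ 10

  tenths-mono-< : ∀ {m n} → m ℕ.< n → tenths m < tenths n
  tenths-mono-< {m} {n} m<n = *-cancelˡ-< (0≤fromℕ 10)
    (<-respˡ-≈ (sym (10*tenths m)) (<-respʳ-≈ (sym (10*tenths n)) (fromℕ-mono-< m<n)))

  9/10≤1 : tenths 9 ≤ 1#
  9/10≤1 = inj₁ (<-respʳ-≈ (⁻¹-inverseʳ (fromℕ 10) (>⇒≉ (0<fromℕ 9))) (tenths-mono-< {9} {10} ℕ.≤-refl))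

  private
    -- Follows the recursion of `fromℕ`, so that the solver computes with these coefficients instead
    -- of treating them as opaque.
    numeral : ∀ {n} → ℕ → Solver.Polynomial n
    numeral zero    = Solver.con 0
    numeral (suc k) = Solver.con 1 Solver.:+ numeral k

  -- With M = 2q blocks the bound reads 3.2q² ≤ 3q² + 2qF.
  budget-too-small : ∀ q {F} → fromℕ 10 * F < fromℕ (suc q) →
    let Q = fromℕ (suc q); m = fromℕ (suc q ℕ.* 2) in
    ¬ (m * (Q * (tenths 8 + tenths 8)) ≤ Q * Q + m * F + m * Q)
  budget-too-small q {F} 10F<Q bound = <⇒≱ lt le
    where
    open Reasoning
    open Solver
    Q = fromℕ (suc q)
    m = fromℕ (suc q ℕ.* 2)
    T = fromℕ 10
    θ = tenths 8
    m≈ : m ≈ Q * fromℕ 2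
    m≈ = fromℕ-* (suc q) 2
    le : T * (m * (Q * (θ + θ))) ≤ T * (Q * Q + m * F + m * Q)
    le = *-monoˡ-≤ (0≤fromℕ 10) bound
    lt : T * (Q * Q + m * F + m * Q) < T * (m * (Q * (θ + θ)))
    lt = begin-strict
      T * (Q * Q + m * F + m * Q)
        ≈⟨ solve 4 (λ T Q m F → T :* (Q :* Q :+ m :* F :+ m :* Q) := m :* (T :* F) :+ (T :* (Q :* Q) :+ T :* (m :* Q)))
             (Reals.refl R) T Q m F ⟩
      m * (T * F) + (T * (Q * Q) + T * (m * Q))
        <⟨ +-mono-<-≤ (*-monoˡ-< (0<fromℕ (suc (q ℕ.* 2))) 10F<Q) ≤-refl ⟩
      m * Q + (T * (Q * Q) + T * (m * Q))
        ≈⟨ +-cong (*-congʳ m≈) (+-congˡ (*-congˡ (*-congʳ m≈))) ⟩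
      (Q * fromℕ 2) * Q + (T * (Q * Q) + T * ((Q * fromℕ 2) * Q))
        -- Coefficients of Q²: 2 + 10 + 20 = 32 = 2 * 16.
        ≈⟨ solve 1 (λ Q → (Q :* numeral 2) :* Q :+ (numeral 10 :* (Q :* Q) :+ numeral 10 :* ((Q :* numeral 2) :* Q))
                          := (Q :* numeral 2) :* (Q :* (numeral 8 :+ numeral 8))) (Reals.refl R) Q ⟩
      (Q * fromℕ 2) * (Q * (fromℕ 8 + fromℕ 8))
        ≈⟨ *-cong m≈ (*-congˡ (+-cong (10*tenths 8) (10*tenths 8))) ⟨
      m * (Q * (T * θ + T * θ))
        ≈⟨ solve 4 (λ T Q m θ → m :* (Q :* (T :* θ :+ T :* θ)) := T :* (m :* (Q :* (θ :+ θ)))) (Reals.refl R) T Q m θ ⟩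
      T * (m * (Q * (θ + θ))) ∎

  littleO-small : ∀ {f} → LittleO f → ∀ a b →
    ∃[ q ] (fromℕ (suc a) * (f (suc q ℕ.* 2 ℕ.* 2) * fromℕ (suc b)) < fromℕ (suc q))
  littleO-small {f} f=o a b = q , *-cancelˡ-< {4′} (inj₁ 0<4′) (begin-strict
    4′ * (fromℕ (suc a) * (f Δ * fromℕ (suc b)))
      ≈⟨ solve 4 (λ t a f b → (t :* t) :* (a :* (f :* b)) := (a :* b :* (t :* t)) :* f) (Reals.refl R)
           (fromℕ 2) (fromℕ (suc a)) (f Δ) (fromℕ (suc b)) ⟩
    K * f Δ               <⟨ *-monoˡ-< 0<K (proj₂ small Δ N≤Δ (ℕ.s≤s ℕ.z≤n)) ⟩
    K * (K ⁻¹ * fromℕ Δ)  ≈⟨ *-assoc _ _ _ ⟨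
    K * K ⁻¹ * fromℕ Δ    ≈⟨ *-congʳ (⁻¹-inverseʳ K (>⇒≉ 0<K)) ⟩
    1# * fromℕ Δ          ≈⟨ *-identityˡ _ ⟩
    fromℕ Δ               ≈⟨ fromℕ-* (suc q ℕ.* 2) 2 ⟩
    fromℕ (suc q ℕ.* 2) * fromℕ 2 ≈⟨ *-congʳ (fromℕ-* (suc q) 2) ⟩
    (fromℕ (suc q) * fromℕ 2) * fromℕ 2
      ≈⟨ solve 2 (λ Q t → (Q :* t) :* t := (t :* t) :* Q) (Reals.refl R) (fromℕ (suc q)) (fromℕ 2) ⟩
    4′ * fromℕ (suc q)    ∎)
    where
    open Reasoning
    open Solver
    4′ = fromℕ 2 * fromℕ 2
    -- The factor 4 is the ratio of Δ to `suc q`. The threshold for ε = 1/K may itself be taken as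
    -- q, since it lies below Δ.
    K = fromℕ (suc a) * fromℕ (suc b) * 4′
    0<4′ : 0# < 4′
    0<4′ = *-pos (0<fromℕ 1) (0<fromℕ 1)
    0<K : 0# < K
    0<K = *-pos (*-pos (0<fromℕ a) (0<fromℕ b)) 0<4′
    small = f=o (K ⁻¹) (⁻¹-pos 0<K)
    q = proj₁ small
    Δ = suc q ℕ.* 2 ℕ.* 2
    N≤Δ : q ℕ.≤ Δ
    N≤Δ = ℕ.≤-trans (ℕ.n≤1+n q) (ℕ.≤-trans (ℕ.m≤m*n (suc q) 2) (ℕ.m≤m*n (suc q ℕ.* 2) 2))

-- Contradiction with instance optimality

module _ (R : Reals) (mode : Mode) (μ : Measure) (W : Pred (Reals.ℝ R) 0ℓ) (ν : Reals.ℝ R) where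

  open Reals R hiding (zero; refl)
  open RealProperties R
  open Constants R

  not-instanceOptimal : 0# < ν → IsMinimum W ν → ∀ q c → fromℕ 10 * (c * fromℕ 17) < fromℕ (suc q) →
                        ∀ A → ¬ InstanceOptimal R μ (InClass R W (suc q ℕ.* 2 ℕ.* 2)) c A
  not-instanceOptimal 0<ν (Wν , ν≤W) q c small A (A-correct , A-optimal) =
    budget-too-small q small
      (total-bound (λ k → proj₁ (variant-succeeds k)) (proj₁ base-succeeds) (suc q) N (initial R base)
        (λ k → ≤-trans (inj₁ (proj₂ (variant-steps k)))
          (Runs.probWithin-mono R (variant k) A _
            (ℕ.≤-trans (proj₂ (upperBound (proj₁ ∘ variant-steps)) k) (ℕ.m≤m⊔n _ (proj₁ base-steps))) _))
        (≤-trans (inj₁ (proj₂ base-steps))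
          (Runs.probWithin-mono R base A _ (ℕ.m≤n⊔m (proj₁ (upperBound (proj₁ ∘ variant-steps))) _) _))
        (λ k → cost-bound k N))
    where
    M = suc q ℕ.* 2
    open Instances R mode M ν
    open LowerBound R mode M ν μ A

    base-succeeds = A-correct base (instanceOf-inClass {W = W} Wν uncrossed)

    variant-succeeds : ∀ k → SucceedsWithProbability≥ R (variant k) A (tenths 9)
    variant-succeeds k = A-correct (variant k) (instanceOf-inClass {W = W} Wν (crossedAt k))

    -- The probability 0.9 is a supremum, so finitely many steps guarantee only smaller values. With
    -- M = 2Q any value above 3/4 would do.
    8<9 : tenths 8 < tenths 9
    8<9 = tenths-mono-< {8} {9} ℕ.≤-refl

    base-steps = proj₂ base-succeeds (tenths 8) 8<9
    variant-steps = λ k → proj₂ (variant-succeeds k) (tenths 8) 8<9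
    N = proj₁ (upperBound (proj₁ ∘ variant-steps)) ℕ.⊔ proj₁ base-steps

    module _ (k : Fin M) where

      p = position (crossedAt k) mode zero k
      open Shortcut R (side mode) (side-departing mode) (toℕ p) ν A

      shortcut-correct : CorrectOn R (InClass R W (M ℕ.* 2)) shortcut
      shortcut-correct x x∈C@(weights∈W , _) =
        shortcut-succeeds x (inj₁ 0<ν) (λ e → ν≤W _ (weights∈W e)) 9/10≤1 (A-correct x x∈C)

      -- The competitor may depend on the instance: on the k-th variant A is compared with the
      -- program that has the position of block k built in.
      cost-bound : ExpectedCost≤ R (variant k) A μ (c * fromℕ 17)
      cost-bound = A-optimal (variant k) (instanceOf-inClass {W = W} Wν (crossedAt k)) shortcut shortcut-correct (fromℕ 17)
        (costWithin-answers (variant k) (λ ()) p refl (<-irrefl (Reals.refl R)) (cong proj₂ (edgeAt-crossed k)) μ)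

theorem6 : (R : Reals) → let open Reals R in
    (mode : Mode) (μ : Measure)
    (W : Pred ℝ 0ℓ) → (∀ w → W w → 0# < w) →
    (ν : ℝ) → IsMinimum W ν →
    (f : ℕ → ℝ) → (∀ Δ → 0# < f Δ) → LittleO f →
    ¬ (Σ[ A ∈ (ℕ → Program R mode) ]
    (∀ Δ → 0 <ℕ Δ → InstanceOptimal R μ (InClass R W Δ) (f Δ) (A Δ)))
theorem6 R mode μ W W-pos ν min@(Wν , _) f _ f=o (A , optimal) =
  -- These stand for the factors 10 and 17: the requirement 10F < Q, and the cost of the competitor
  -- on its own variant.
  let (q , small) = Constants.littleO-small R f=o 9 16
      Δ = suc q ℕ.* 2 ℕ.* 2
  in not-instanceOptimal R mode μ W ν (W-pos ν Wν) min q (f Δ) small (A Δ) (optimal Δ (ℕ.s≤s ℕ.z≤n))
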